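{- Let $d\ge1$ and $k\ge0$. The number of noncrossing partitions $\pi$ of $[dk+1]$ such that every block of $\pi$ has size $1$ or $d+1$ and every block of the Kreweras dual $\pi'$ has size $1$ or $d+1$ is $$\frac{2}{dk+2}\binom{dk+2}{k}.$$ If one further requires that $\{1\}$ is a (singleton) block of $\pi$, the number is $$\frac{1}{dk+1}\binom{dk+1}{k}.$$
   Context: A partition of $[n]$ is noncrossing if there are no $i<j<k<\ell$ with $i,k$ in one block and $j,\ell$ in a different block. The Kreweras dual $\pi'$ of a noncrossing partition $\pi$ of $[n]$: place $1,1',2,2',\dots,n,n'$ on a circle in this cyclic order; $\pi'$ is the coarsest partition of $\{1',\dots,n'\}$ such that the blocks of $\pi$ and of $\pi'$ together form a noncrossing partition of these $2n$ points. -}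

module Defs where

open import Data.Nat using (ℕ; zero; suc; _+_; _*_; _<_)
open import Data.Bool using (Bool; true; false)
open import Data.Fin using (Fin; toℕ)
open import Data.Vec using (Vec; lookup)
open import Data.List using (List; length)
open import Data.List.Membership.Propositional using (_∈_)
open import Data.List.Relation.Unary.Unique.Propositional using (Unique)
open import Data.Product using (Σ; _×_)
open import Data.Sum using (_⊎_)
open import Relation.Nullary using (¬_)
open import Relation.Binary.PropositionalEquality using (_≡_)
open import Function.Bundles using (_⇔_)

-- A binary relation on [n] = Fin n (0-based: element i+1 of [n] is index i),
-- stored as a Boolean n×n matrix so that equal relations are equal values.
Rel : ℕ → Set
Rel n = Vec (Vec Bool n) n

_∼[_]_ : {n : ℕ} → Fin n → Rel n → Fin n → Set
i ∼[ R ] j = lookup (lookup R i) j ≡ true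

record IsPartition {n : ℕ} (R : Rel n) : Set where
  field
    refl  : ∀ i → i ∼[ R ] i
    sym   : ∀ i j → i ∼[ R ] j → j ∼[ R ] i
    trans : ∀ i j l → i ∼[ R ] j → j ∼[ R ] l → i ∼[ R ] l

Noncrossing : (ℕ → ℕ → Set) → ℕ → Set
Noncrossing S m = ∀ a b c e → a < b → b < c → c < e → e < m →
  ¬ (S a c × S b e × ¬ S a b)

IsNoncrossingPartition : {n : ℕ} → Rel n → Set
IsNoncrossingPartition {n} R =
  IsPartition R × Noncrossing (λ a b → Σ (Fin n) λ i → Σ (Fin n) λ j →
                                  a ≡ toℕ i × b ≡ toℕ j × i ∼[ R ] j) n

trues : {m : ℕ} → Vec Bool m → ℕ
trues Vec.[] = 0
trues (true Vec.∷ v) = suc (trues v)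
trues (false Vec.∷ v) = trues v

blockSize : {n : ℕ} → Rel n → Fin n → ℕ
blockSize R i = trues (lookup R i)

BlocksOfSize1or : {n : ℕ} → ℕ → Rel n → Set
BlocksOfSize1or d R = ∀ i → blockSize R i ≡ 1 ⊎ blockSize R i ≡ suc d

-- The 2n points 1,1',2,2',…,n,n' in cyclic order: point i (0-based) sits at
-- position 2i and point i' at position 2i+1.  Same-block relation of the
-- partition of the 2n points whose blocks are those of π and of σ (σ on primes).
data Combined {n : ℕ} (π σ : Rel n) : ℕ → ℕ → Set where
  unprimed : ∀ i j → i ∼[ π ] j → Combined π σ (2 * toℕ i) (2 * toℕ j)
  primed   : ∀ i j → i ∼[ σ ] j → Combined π σ (suc (2 * toℕ i)) (suc (2 * toℕ j))

record IsKrewerasDual {n : ℕ} (π σ : Rel n) : Set where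
  field
    partition   : IsPartition σ
    noncrossing : Noncrossing (Combined π σ) (2 * n)
    coarsest    : ∀ (τ : Rel n) → IsPartition τ →
                  Noncrossing (Combined π τ) (2 * n) →
                  ∀ i j → i ∼[ τ ] j → i ∼[ σ ] j

HasCardinality : {n : ℕ} → (Rel n → Set) → ℕ → Set
HasCardinality {n} P N = Σ (List (Rel n)) λ L →
  Unique L × (∀ R → (R ∈ L) ⇔ P R) × length L ≡ N

Good : {n : ℕ} → ℕ → Rel n → Set
Good d π = IsNoncrossingPartition π × BlocksOfSize1or d π ×
  Σ (Rel _) λ σ → IsKrewerasDual π σ × BlocksOfSize1or d σ

{-# OPTIONS --safe #-}

-- Draw π and its Kreweras dual π′ on the 2n points 1,1′,…,n,n′. Between two consecutive points x < y of a
-- block, the points x + 1 and y - 1 are the first and the last point of one block, so the combined partition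
-- is read off as an ordered forest: a block with m + 1 points is a vertex with m children, one per gap. The
-- only exception is at the top level, where the block of 1 and the block of n′ stand side by side. Hence the
-- combined partitions correspond to pairs of trees with n + 1 vertices altogether, and the size condition says
-- that every vertex has 0 or d children. These pairs, with k vertices of arity d, are counted by the recurrence
-- F(m+1, k+1) = F(m, k+1) + F(m+d, k) for forests of m trees, solved by F(m, k) = m / (dk+m) · C(dk+m, k).
-- The block of 1 is a singleton when the first tree is a leaf, which leaves F(1, k).

module Submission where

open import Defs
open import Data.Bool using (Bool; true; false; not; if_then_else_)
open import Data.Bool.Properties using (not-involutive; not-¬; ¬-not; T-≡) renaming (_≟_ to _≟ᵇ_)
open import Data.Empty using (⊥)
open import Data.Fin using (Fin; zero; suc; toℕ; fromℕ<)
open import Data.Fin.Properties using (toℕ<n; toℕ-injective; toℕ-fromℕ<; any?)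
open import Data.List using (List; []; _∷_; length; map) renaming (_++_ to _++ˡ_)
open import Data.List.Membership.Propositional using (_∈_)
open import Data.List.Membership.Propositional.Properties using (∈-map⁺; ∈-map⁻; ∈-++⁺ˡ; ∈-++⁺ʳ; ∈-++⁻)
open import Data.List.Properties using (length-++; length-map)
import Data.List.Relation.Unary.All as All
import Data.List.Relation.Unary.All.Properties as All
open import Data.List.Relation.Unary.Any using (here; there)
open import Data.List.Relation.Unary.Unique.Propositional using (Unique; []; _∷_)
import Data.List.Relation.Unary.Unique.Propositional.Properties as Unique
open import Data.Nat
open import Data.Nat.Combinatorics using (_C_; nC1≡n; nCk+nC[k+1]≡[n+1]C[k+1])
open import Data.Nat.Properties
open import Data.Nat.Tactic.RingSolver using (solve-∀)
open import Data.Product using (Σ; ∃; ∃₂; _×_; _,_; proj₁; proj₂)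
open import Data.Sum using (_⊎_; inj₁; inj₂; [_,_]′)
open import Data.Vec using (Vec; []; _∷_; lookup; tabulate)
open import Data.Vec.Properties using (lookup∘tabulate; tabulate∘lookup; tabulate-cong)
open import Function using (_∘_)
open import Function.Bundles using (_⇔_; mk⇔; Equivalence)
open import Relation.Binary.Definitions using (tri<; tri≈; tri>)
open import Relation.Binary.PropositionalEquality
open import Relation.Nullary using (¬_; Dec; contradiction; yes; no; does)
open import Relation.Nullary.Decidable using (dec-true; dec-false; _×-dec_; _⊎-dec_; map′; decidable-stable)
open import Relation.Unary using (Decidable)

-- The bridge between partitions and trees is the labelling of the 2n points by the first point of
-- their block. No inverse map is written down: the relation `Spells` says that a labelling and a
-- forest describe the same picture, and noncrossing, block sizes and separation are proved by
-- induction on it. Maximality of the dual is used in both directions. From trees to partitions, two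
-- primed points in different blocks are separated by two points of one block of π, so no dual
-- candidate can join them. From partitions to trees, suppose that the last point of a block is
-- followed by the first point of another. Then two further primed points could be joined without a
-- crossing, unless the earlier block is that of 1; this is the force of `closing`, and the cut of
-- the circle between n′ and 1 causes its exception. With n = dk + 1 a pair of trees has dk + 2
-- vertices: two roots and dk children, hence k vertices of arity d.

open Equivalence using (to; from)

-- Plane forests

-- cons g f is the forest whose first tree has the forest g of children and whose other trees form f.
data Forest : Set where
  nil  : Forest
  cons : Forest → Forest → Forest

width size : Forest → ℕ
width nil        = 0
width (cons g f) = suc (width f)
size nil        = 0
size (cons g f) = suc (size g + size f)

_++_ : Forest → Forest → Forest
nil      ++ h = h
cons g f ++ h = cons g (f ++ h)

take drop : ℕ → Forest → Forest
take zero    f          = nil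
take (suc m) nil        = nil
take (suc m) (cons g f) = cons g (take m f)
drop zero    f          = f
drop (suc m) nil        = nil
drop (suc m) (cons g f) = drop m f

data Arities (d : ℕ) : Forest → Set where
  nil  : Arities d nil
  cons : ∀ {g f} → width g ≡ 0 ⊎ width g ≡ d → Arities d g → Arities d f → Arities d (cons g f)

width≤size : ∀ f → width f ≤ size f
width≤size nil        = z≤n
width≤size (cons g f) = s≤s (≤-trans (width≤size f) (m≤n+m _ (size g)))

width≡0⇒nil : ∀ f → width f ≡ 0 → f ≡ nil
width≡0⇒nil nil _ = refl

width-++ : ∀ f h → width (f ++ h) ≡ width f + width h
width-++ nil        h = refl
width-++ (cons g f) h = cong suc (width-++ f h)

size-++ : ∀ f h → size (f ++ h) ≡ size f + size h
size-++ nil        h = refl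
size-++ (cons g f) h = cong suc (trans (cong (size g +_) (size-++ f h)) (sym (+-assoc (size g) (size f) (size h))))

Arities-++ : ∀ {d f h} → Arities d f → Arities d h → Arities d (f ++ h)
Arities-++ nil          b = b
Arities-++ (cons w a c) b = cons w a (Arities-++ c b)

take++drop : ∀ m f → take m f ++ drop m f ≡ f
take++drop zero    f          = refl
take++drop (suc m) nil        = refl
take++drop (suc m) (cons g f) = cong (cons g) (take++drop m f)

width-take : ∀ m {n} f → width f ≡ m + n → width (take m f) ≡ m
width-take zero    f          e = refl
width-take (suc m) (cons g f) e = cong suc (width-take m f (suc-injective e))

take-++ : ∀ f h → take (width f) (f ++ h) ≡ f
take-++ nil        h = refl
take-++ (cons g f) h = cong (cons g) (take-++ f h)

drop-++ : ∀ f h → drop (width f) (f ++ h) ≡ h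
drop-++ nil        h = refl
drop-++ (cons g f) h = drop-++ f h

Arities-take : ∀ {d} m {f} → Arities d f → Arities d (take m f)
Arities-take zero    a            = nil
Arities-take (suc m) nil          = nil
Arities-take (suc m) (cons w a b) = cons w a (Arities-take m b)

Arities-drop : ∀ {d} m {f} → Arities d f → Arities d (drop m f)
Arities-drop zero    a            = a
Arities-drop (suc m) nil          = nil
Arities-drop (suc m) (cons w a b) = Arities-drop m b

-- Enumeration of the forests with arities 0 and d

graft : ℕ → Forest → Forest
graft d f = cons (take d f) (drop d f)

-- The recurrence removes the first root: a leaf disappears, while a root of arity `d` leaves its
-- `d` subtrees in front of the other `m` trees.
forests : ℕ → ℕ → ℕ → List Forest
forests d zero    zero    = nil ∷ []
forests d zero    (suc k) = []
forests d (suc m) zero    = map (cons nil) (forests d m zero)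
forests d (suc m) (suc k) = map (cons nil) (forests d m (suc k)) ++ˡ map (graft d) (forests d (d + m) k)

-- The `m` roots and `d` children for each inner vertex make up all vertices, so for nonzero `d` the
-- size determines the number `k` of inner vertices.
IsForest : ℕ → ℕ → ℕ → Forest → Set
IsForest d m k f = Arities d f × width f ≡ m × size f ≡ m + d * k

graft-injective : ∀ d {f h} → graft d f ≡ graft d h → f ≡ h
graft-injective d {f} {h} e with take d f | drop d f | take++drop d f | e
... | _ | _ | refl | refl = take++drop d h

cons-nil-isForest : ∀ {d m k f} → IsForest d m k f → IsForest d (suc m) k (cons nil f)
cons-nil-isForest (a , w , s) = cons (inj₁ refl) nil a , cong suc w , cong suc s

graft-isForest : ∀ {d m k f} → IsForest d (d + m) k f → IsForest d (suc m) (suc k) (graft d f)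
graft-isForest {d} {m} {k} {f} (a , w , s) =
  cons (inj₂ (width-take d f w)) (Arities-take d a) (Arities-drop d a) , cong suc w′ , cong suc s′
  where
  open ≡-Reasoning
  w′ : width (drop d f) ≡ m
  w′ = +-cancelˡ-≡ d (width (drop d f)) m (begin
    d + width (drop d f)                 ≡⟨ cong (_+ width (drop d f)) (width-take d f w) ⟨
    width (take d f) + width (drop d f)  ≡⟨ width-++ (take d f) (drop d f) ⟨
    width (take d f ++ drop d f)         ≡⟨ cong width (take++drop d f) ⟩
    width f                              ≡⟨ w ⟩
    d + m                                ∎)
  rearrange : ∀ d m k → d + m + d * k ≡ m + (d + d * k)
  rearrange = solve-∀
  s′ : size (take d f) + size (drop d f) ≡ m + d * suc k
  s′ = begin
    size (take d f) + size (drop d f)  ≡⟨ size-++ (take d f) (drop d f) ⟨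
    size (take d f ++ drop d f)        ≡⟨ cong size (take++drop d f) ⟩
    size f                             ≡⟨ s ⟩
    d + m + d * k                      ≡⟨ rearrange d m k ⟩
    m + (d + d * k)                    ≡⟨ cong (m +_) (*-suc d k) ⟨
    m + d * suc k                      ∎

map-elim : ∀ {A B : Set} (P : B → Set) (F : A → B) {xs} → (∀ {x} → x ∈ xs → P (F x)) → ∀ {y} → y ∈ map F xs → P y
map-elim P F p q with ∈-map⁻ F q
... | x , r , refl = p r

forests-sound : ∀ d m k {f} → f ∈ forests d m k → IsForest d m k f
forests-sound d zero    zero    (here refl) = nil , refl , sym (*-zeroʳ d)
forests-sound d (suc m) zero    p =
  map-elim (IsForest d (suc m) zero) (cons nil) (λ q → cons-nil-isForest {d} {m} {zero} (forests-sound d m zero q)) p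
forests-sound d (suc m) (suc k) p =
  [ map-elim (IsForest d (suc m) (suc k)) (cons nil) (λ q → cons-nil-isForest {d} {m} {suc k} (forests-sound d m (suc k) q))
  , map-elim (IsForest d (suc m) (suc k)) (graft d) (λ q → graft-isForest {d} {m} {k} (forests-sound d (d + m) k q))
  ]′ (∈-++⁻ (map (cons nil) (forests d m (suc k))) p)

forests-complete : ∀ d .{{_ : NonZero d}} m k {f} → IsForest d m k f → f ∈ forests d m k
forests-complete d zero    zero    {nil}      _           = here refl
forests-complete d zero    (suc k) {nil}      (_ , _ , s) =
    contradiction (sym s) (≢-nonZero⁻¹ (d * suc k) {{m*n≢0 d (suc k)}})
forests-complete d zero    _       {cons g f} (_ , () , _)
forests-complete d (suc m) k       {nil}      (_ , () , _)
forests-complete d (suc m) k       {cons g f} (cons (inj₁ w₀) _ a , w , s) with width≡0⇒nil g w₀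
... | refl = leaf k s
  where
  leaf : ∀ k → size (cons nil f) ≡ suc m + d * k → cons nil f ∈ forests d (suc m) k
  leaf zero    s = ∈-map⁺ (cons nil) (forests-complete d m zero (a , suc-injective w , suc-injective s))
  leaf (suc k) s = ∈-++⁺ˡ (∈-map⁺ (cons nil) (forests-complete d m (suc k) (a , suc-injective w , suc-injective s)))
-- For `k = 0` the size allows only `m` vertices besides the first root, but its `d` children and
-- the other `m` roots are already `d + m`.
forests-complete d (suc m) zero    {cons g f} (cons (inj₂ refl) _ a , w , s) =
  contradiction (trans (suc-injective s) (trans (cong (m +_) (*-zeroʳ d)) (+-identityʳ m)))
    (>⇒≢ (≤-trans (+-monoˡ-≤ m (>-nonZero⁻¹ d)) (+-mono-≤ (width≤size g)
      (≤-trans (≤-reflexive (sym (suc-injective w))) (width≤size f)))))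
forests-complete d (suc m) (suc k) {cons g f} (cons (inj₂ refl) b a , w , s) =
  ∈-++⁺ʳ (map (cons nil) (forests d m (suc k)))
    (subst (_∈ map (graft d) (forests d (d + m) k)) (cong₂ cons (take-++ g f) (drop-++ g f))
      (∈-map⁺ (graft d) (forests-complete d (d + m) k
        (Arities-++ b a , trans (width-++ g f) (cong (d +_) (suc-injective w)) , s′))))
  where
  open ≡-Reasoning
  rearrange : ∀ d m k → m + (d + d * k) ≡ d + m + d * k
  rearrange = solve-∀
  s′ : size (g ++ f) ≡ d + m + d * k
  s′ = begin
    size (g ++ f)     ≡⟨ size-++ g f ⟩
    size g + size f   ≡⟨ suc-injective s ⟩
    m + d * suc k     ≡⟨ cong (m +_) (*-suc d k) ⟩
    m + (d + d * k)   ≡⟨ rearrange d m k ⟩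
    d + m + d * k     ∎

forests-unique : ∀ d .{{_ : NonZero d}} m k → Unique (forests d m k)
forests-unique d zero    zero    = All.[] ∷ []
forests-unique d zero    (suc k) = []
forests-unique d (suc m) zero    = Unique.map⁺ (λ { refl → refl }) (forests-unique d m zero)
forests-unique d (suc m) (suc k) =
  Unique.++⁺ (Unique.map⁺ (λ { refl → refl }) (forests-unique d m (suc k)))
    (Unique.map⁺ (graft-injective d) (forests-unique d (d + m) k)) disjoint
  where
  -- The first root has arity 0 in one list and arity `d`, which is nonzero, in the other.
  disjoint : ∀ {f} → ¬ (f ∈ map (cons nil) (forests d m (suc k)) × f ∈ map (graft d) (forests d (d + m) k))
  disjoint (p , q) with ∈-map⁻ (cons nil) p | ∈-map⁻ (graft d) q
  ... | _ , _ , refl | f , r , e with cong (λ { nil → 0 ; (cons g _) → width g }) e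
  ...   | 0≡w = ≢-nonZero⁻¹ d (sym (trans 0≡w (width-take d f (proj₁ (proj₂ (forests-sound d (d + m) k r))))))

-- The identity (k + 1) C(n, k + 1) = (n - k) C(n, k) without subtraction.
absorption : ∀ n k → suc k * (n C suc k) + k * (n C k) ≡ n * (n C k)
absorption zero    zero    = refl
absorption zero    (suc k) = cong₂ _+_ (*-zeroʳ (suc (suc k))) (*-zeroʳ (suc k))
absorption (suc n) zero    =
    trans (+-identityʳ _) (trans (*-identityˡ _) (trans (nC1≡n (suc n)) (sym (*-identityʳ (suc n)))))
absorption (suc n) (suc k) = begin
  suc (suc k) * (suc n C suc (suc k)) + suc k * (suc n C suc k)
    ≡⟨ cong₂ (λ x y → suc (suc k) * x + suc k * y) (nCk+nC[k+1]≡[n+1]C[k+1] n (suc k)) (nCk+nC[k+1]≡[n+1]C[k+1] n k) ⟨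
  suc (suc k) * (a + b) + suc k * (c + a)                         ≡⟨ lhs k a b c ⟩
  suc (suc k) * b + suc k * a + (suc k * a + k * c) + (c + a)
    ≡⟨ cong₂ (λ x y → x + y + (c + a)) (absorption n (suc k)) (absorption n k) ⟩
  n * a + n * c + (c + a)                                         ≡⟨ rhs n a c ⟩
  suc n * (c + a)                                                 ≡⟨ cong (suc n *_) (nCk+nC[k+1]≡[n+1]C[k+1] n k) ⟩
  suc n * (suc n C suc k)                                         ∎
  where
  open ≡-Reasoning
  a = n C suc k
  b = n C suc (suc k)
  c = n C k
  lhs : ∀ k a b c →
        suc (suc k) * (a + b) + suc k * (c + a) ≡ suc (suc k) * b + suc k * a + (suc k * a + k * c) + (c + a)
  lhs = solve-∀
  rhs : ∀ n a c → n * a + n * c + (c + a) ≡ suc n * (c + a)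
  rhs = solve-∀

-- The number of forests in closed form

length-forests-0 : ∀ d m → length (forests d m 0) ≡ 1
length-forests-0 d zero    = refl
length-forests-0 d (suc m) = trans (length-map (cons nil) (forests d m 0)) (length-forests-0 d m)

-- The recurrence with denominators cleared, where `X` and `Y` stand for C(A, k + 1) and C(A, k).
-- The extra factor `A` makes both induction hypotheses applicable, and absorption trades the
-- product `A * Y` for `X` and `Y`.
ballot-step : ∀ d m k A F₁ F₂ X Y → A ≡ d * suc k + m → F₁ * A ≡ m * X → F₂ * A ≡ (d + m) * Y →
  suc k * X + k * Y ≡ A * Y → A * ((F₁ + F₂) * suc A) ≡ A * (suc m * (Y + X))
ballot-step d m k A F₁ F₂ X Y eA e₁ e₂ e₃ = begin
  A * ((F₁ + F₂) * suc A)                                            ≡⟨ step₁ A F₁ F₂ ⟩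
  (F₁ * A + F₂ * A) * suc A                                          ≡⟨ cong₂ (λ x y → (x + y) * suc A) e₁ e₂ ⟩
  (m * X + (d + m) * Y) * suc A                                      ≡⟨ step₂ A d m X Y ⟩
  A * m * X + A * m * Y + (m * X + d * (A * Y) + (d + m) * Y)
    ≡⟨ cong (λ x → A * m * X + A * m * Y + (m * X + d * x + (d + m) * Y)) e₃ ⟨
  A * m * X + A * m * Y + (m * X + d * (suc k * X + k * Y) + (d + m) * Y)
    ≡⟨ cong (A * m * X + A * m * Y +_) (step₃ d m k X Y) ⟩
  A * m * X + A * m * Y + (d * suc k + m) * (X + Y)
    ≡⟨ cong (λ x → A * m * X + A * m * Y + x * (X + Y)) eA ⟨
  A * m * X + A * m * Y + A * (X + Y)                                ≡⟨ step₄ A m X Y ⟩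
  A * (suc m * (Y + X))                                              ∎
  where
  open ≡-Reasoning
  step₁ : ∀ A F₁ F₂ → A * ((F₁ + F₂) * suc A) ≡ (F₁ * A + F₂ * A) * suc A
  step₁ = solve-∀
  step₂ : ∀ A d m X Y → (m * X + (d + m) * Y) * suc A ≡ A * m * X + A * m * Y + (m * X + d * (A * Y) + (d + m) * Y)
  step₂ = solve-∀
  step₃ : ∀ d m k X Y → m * X + d * (suc k * X + k * Y) + (d + m) * Y ≡ (d * suc k + m) * (X + Y)
  step₃ = solve-∀
  step₄ : ∀ A m X Y → A * m * X + A * m * Y + A * (X + Y) ≡ A * (suc m * (Y + X))
  step₄ = solve-∀

-- Both terms of the recurrence have the same value `A` of `d * k + m`, so their binomials are
-- neighbours in row `A` and Pascal's rule adds them. The factor `A` cancels because it is positive.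
length-forests : ∀ d .{{_ : NonZero d}} m k → length (forests d m k) * (d * k + m) ≡ m * ((d * k + m) C k)
length-forests d zero    zero    = trans (+-identityʳ _) (trans (+-identityʳ _) (*-zeroʳ d))
length-forests d zero    (suc k) = refl
length-forests d (suc m) zero    rewrite length-forests-0 d (suc m) | *-zeroʳ d =
    trans (+-identityʳ _) (sym (*-identityʳ (suc m)))
length-forests d (suc m) (suc k) = begin
  length (forests d (suc m) (suc k)) * (d * suc k + suc m)  ≡⟨ cong₂ _*_ length≡ (+-suc (d * suc k) m) ⟩
  (F₁ + F₂) * suc A                                         ≡⟨ *-cancelˡ-≡ _ _ A {{A≢0}}
                                                                 (ballot-step d m k A F₁ F₂ (A C suc k) (A C k) refl
                                                                   (length-forests d m (suc k)) e₂ (absorption A k)) ⟩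
  suc m * (A C k + A C suc k)                               ≡⟨ cong (suc m *_) (nCk+nC[k+1]≡[n+1]C[k+1] A k) ⟩
  suc m * (suc A C suc k)
    ≡⟨ cong (λ x → suc m * (x C suc k)) (+-suc (d * suc k) m) ⟨
  suc m * ((d * suc k + suc m) C suc k)                     ∎
  where
  open ≡-Reasoning
  A  = d * suc k + m
  F₁ = length (forests d m (suc k))
  F₂ = length (forests d (d + m) k)
  A≢0 : NonZero A
  A≢0 = >-nonZero (≤-trans (>-nonZero⁻¹ (d * suc k) {{m*n≢0 d (suc k)}}) (m≤m+n _ m))
  rearrange : ∀ d m k → d * k + (d + m) ≡ d * suc k + m
  rearrange = solve-∀
  e₂ : F₂ * A ≡ (d + m) * (A C k)
  e₂ = subst (λ x → F₂ * x ≡ (d + m) * (x C k)) (rearrange d m k) (length-forests d (d + m) k)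
  length≡ : length (forests d (suc m) (suc k)) ≡ F₁ + F₂
  length≡ = trans (length-++ (map (cons nil) (forests d m (suc k))))
    (cong₂ _+_ (length-map (cons nil) (forests d m (suc k))) (length-map (graft d) (forests d (d + m) k)))

-- Forests spelled by a labelling

odd : ℕ → Bool
odd zero    = false
odd (suc n) = not (odd n)

odd-n+2*m : ∀ n m → odd (n + 2 * m) ≡ odd n
odd-n+2*m n zero    = cong odd (+-identityʳ n)
odd-n+2*m n (suc m) rewrite +-identityʳ m | +-suc n (m + suc m) | +-suc m m | +-suc n (m + m) =
  trans (not-involutive _) (trans (cong (λ x → odd (n + (m + x))) (sym (+-identityʳ m))) (odd-n+2*m n m))

-- The label v x of a point x is the first point of its block, so x is fresh when v x ≡ x. On [p, r) the labelling
-- spells the gaps of a block with first point ℓ: each gap holds one tree and is closed by a point labelled ℓ.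
data Spells (v : ℕ → ℕ) (ℓ : ℕ) : ℕ → Forest → ℕ → Set where
  nil  : ∀ {p} → Spells v ℓ p nil p
  cons : ∀ {p q r g f} → v p ≡ p → Spells v p (suc p) g q → v q ≡ ℓ → Spells v ℓ (suc q) f r →
         Spells v ℓ p (cons g f) r

-- The block of 1 ends right before `split`. The block that begins there reaches the last point, so
-- it is the block of n′.
record Spelling (v : ℕ → ℕ) (N : ℕ) (g h : Forest) : Set where
  constructor spelling
  field
    {split} : ℕ
    start  : v 0 ≡ 0
    first  : Spells v 0 1 g split
    middle : v split ≡ split
    second : Spells v split (suc split) h N

module _ {v : ℕ → ℕ} where

  -- Each vertex accounts for two points: the first point of its block and the point of the parent
  -- block that closes its gap.
  spells-end : ∀ {ℓ p f r} → Spells v ℓ p f r → r ≡ p + 2 * size f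
  spells-end {p = p} nil = sym (+-identityʳ p)
  spells-end {p = p} (cons {g = g} {f} _ s _ t) =
    trans (spells-end t) (trans (cong (λ x → suc x + 2 * size f) (spells-end s)) (rearrange p (size g) (size f)))
    where
    rearrange : ∀ p a b → suc (suc p + 2 * a) + 2 * b ≡ p + 2 * suc (a + b)
    rearrange = solve-∀

  spells-≤ : ∀ {ℓ p f r} → Spells v ℓ p f r → p ≤ r
  spells-≤ {p = p} {f} s = subst (p ≤_) (sym (spells-end s)) (m≤m+n p _)

  odd-end : ∀ {ℓ p f r} → Spells v ℓ p f r → odd r ≡ odd p
  odd-end {p = p} {f} s = trans (cong odd (spells-end s)) (odd-n+2*m p (size f))

data Region (p q r x : ℕ) : Set where
  at-p   : x ≡ p → Region p q r x
  inside : p < x → x < q → Region p q r x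
  at-q   : x ≡ q → Region p q r x
  after  : q < x → x < r → Region p q r x

region : ∀ {p q r x} → p ≤ x → x < r → Region p q r x
region {p} {q} {r} {x} p≤x x<r with <-cmp x q
... | tri≈ _ x≡q _ = at-q x≡q
... | tri> _ _ q<x = after q<x x<r
... | tri< x<q _ _ with m≤n⇒m<n∨m≡n p≤x
...   | inj₁ p<x = inside p<x x<q
...   | inj₂ p≡x = at-p (sym p≡x)

module _ {v : ℕ → ℕ} where

  spells-range : ∀ {ℓ p f r} → Spells v ℓ p f r → ∀ {x} → p ≤ x → x < r →
                 v x ≡ ℓ ⊎ (p ≤ v x × v x ≤ x × v (v x) ≡ v x)
  spells-range nil p≤x x<r = contradiction x<r (≤⇒≯ p≤x)
  spells-range (cons {q = q} e s e′ t) p≤x x<r with region {q = q} p≤x x<r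
  ... | at-p refl = inj₂ (≤-reflexive (sym e) , ≤-reflexive e , cong v e)
  ... | at-q refl = inj₁ e′
  ... | inside p<x x<q with spells-range s p<x x<q
  ...   | inj₁ e″            =
      inj₂ (≤-reflexive (sym e″) , ≤-trans (≤-reflexive e″) p≤x , trans (cong v e″) (trans e (sym e″)))
  ...   | inj₂ (a , b , c)   = inj₂ (≤-trans (n≤1+n _) a , b , c)
  spells-range (cons e s e′ t) p≤x x<r | after q<x x<r′ with spells-range t q<x x<r′
  ...   | inj₁ e″            = inj₁ e″
  ...   | inj₂ (a , b , c)   = inj₂ (≤-trans (≤-trans (n≤1+n _) (m≤n⇒m≤1+n (spells-≤ s))) a , b , c)

  spells-last : ∀ {ℓ b f r} → v b ≡ ℓ → Spells v ℓ (suc b) f (suc r) → v r ≡ ℓ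
  spells-last e nil = e
  spells-last e (cons _ _ e′ t) = spells-last e′ t

  -- A gap holds an odd number of points, one for its root and two for every other vertex, so
  -- consecutive points of a block have the same colour.
  spells-odd : ∀ {ℓ b f r} → odd ℓ ≡ odd b → Spells v ℓ (suc b) f r → ∀ {x} → b < x → x < r → odd (v x) ≡ odd x
  spells-odd o nil b<x x<r = contradiction x<r (≤⇒≯ b<x)
  spells-odd {ℓ} {b} o (cons {q = q} e s e′ t) b<x x<r with region {q = q} b<x x<r
  ... | at-p refl      = cong odd e
  ... | inside p<x x<q = spells-odd refl s p<x x<q
  ... | at-q refl      = trans (cong odd e′) q-odd
    where q-odd = trans o (trans (sym (not-involutive _)) (sym (odd-end s)))
  ... | after q<x x<r′ = spells-odd (trans o (trans (sym (not-involutive _)) (sym (odd-end s)))) t q<x x<r′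

  inside-label : ∀ {p g q} → v p ≡ p → Spells v p (suc p) g q → ∀ {x} → p ≤ x → x < q → p ≤ v x × v x < q
  inside-label e s {x} p≤x x<q with m≤n⇒m<n∨m≡n p≤x
  ... | inj₂ refl = ≤-reflexive (sym e) , subst (_< _) (sym e) x<q
  ... | inj₁ p<x with spells-range s p<x x<q
  ...   | inj₁ e″          = ≤-reflexive (sym e″) , ≤-<-trans (≤-reflexive e″) (<-trans p<x x<q)
  ...   | inj₂ (a , b , _) = ≤-trans (n≤1+n _) a , ≤-<-trans b x<q

  outside-label : ∀ {ℓ q f r} → v q ≡ ℓ → Spells v ℓ (suc q) f r → ∀ {x} → q ≤ x → x < r → v x ≡ ℓ ⊎ q < v x
  outside-label e s {x} q≤x x<r with m≤n⇒m<n∨m≡n q≤x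
  ... | inj₂ refl = inj₁ e
  ... | inj₁ q<x with spells-range s q<x x<r
  ...   | inj₁ e″          = inj₁ e″
  ...   | inj₂ (a , b , _) = inj₂ a

  inside≢outside : ∀ {ℓ p g q f r} → ℓ < p → v p ≡ p → Spells v p (suc p) g q → v q ≡ ℓ → Spells v ℓ (suc q) f r →
                   ∀ {x y} → p ≤ x → x < q → q ≤ y → y < r → v x ≢ v y
  inside≢outside ℓ<p e s e′ t p≤x x<q q≤y y<r vx≡vy with inside-label e s p≤x x<q | outside-label e′ t q≤y y<r
  ... | a , b | inj₁ c = <⇒≱ ℓ<p (≤-trans a (≤-reflexive (trans vx≡vy c)))
  ... | a , b | inj₂ c = <-asym b (<-≤-trans c (≤-reflexive (sym vx≡vy)))

  inside≢ℓ : ∀ {ℓ p g q} → ℓ < p → v p ≡ p → Spells v p (suc p) g q → ∀ {x} → p ≤ x → x < q → v x ≢ ℓ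
  inside≢ℓ ℓ<p e s p≤x x<q vx≡ℓ = <⇒≱ ℓ<p (≤-trans (proj₁ (inside-label e s p≤x x<q)) (≤-reflexive vx≡ℓ))

  -- The block point `b` before the first gap is included so that the induction can step over that
  -- gap: if `x` is `b` and `y` lies beyond the gap, the closing point `q` has the same label and
  -- takes the place of `x`.
  spells-noncrossing : ∀ {ℓ b f r} → v b ≡ ℓ → ℓ ≤ b → Spells v ℓ (suc b) f r →
    ∀ {x y z w} → b ≤ x → x < y → y < z → z < w → w < r → v x ≡ v z → v y ≡ v w → v x ≡ v y
  spells-noncrossing _ _ nil b≤x x<y y<z z<w w<r _ _ =
    contradiction (<-≤-trans (<-trans x<y (<-trans y<z z<w)) (s≤s⁻¹ w<r)) (≤⇒≯ b≤x)
  spells-noncrossing {ℓ} {b} vb ℓ≤b (cons {q = q} e s e′ t) {x} {y} {z} {w} b≤x x<y y<z z<w w<r vx≡vz vy≡vw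
    with x <? q
  ... | no x≮q = spells-noncrossing e′ (≤-trans ℓ≤b (≤-trans (n≤1+n _) (≤-trans (n≤1+n _) (spells-≤ s)))) t
                   (≮⇒≥ x≮q) x<y y<z z<w w<r vx≡vz vy≡vw
  ... | yes x<q with m≤n⇒m<n∨m≡n b≤x
  ...   | inj₁ b<x with z <? q
  ...     | no z≮q = contradiction vx≡vz (inside≢outside (s≤s ℓ≤b) e s e′ t b<x x<q (≮⇒≥ z≮q) (<-trans z<w w<r))
  ...     | yes z<q with w <? q
  ...       | yes w<q = spells-noncrossing e ≤-refl s b<x x<y y<z z<w w<q vx≡vz vy≡vw
  ...       | no w≮q  = contradiction vy≡vw
                          (inside≢outside (s≤s ℓ≤b) e s e′ t (<-trans b<x x<y) (<-trans y<z z<q) (≮⇒≥ w≮q) w<r)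
  spells-noncrossing {ℓ} {b} vb ℓ≤b (cons {q = q} e s e′ t) {x} {y} {z} {w} b≤x x<y y<z z<w w<r vx≡vz vy≡vw
      | yes x<q | inj₂ refl with <-cmp y q
  ...     | tri≈ _ refl _ = trans vb (sym e′)
  ...     | tri> _ _ q<y  = trans vb (trans (sym e′)
                              (spells-noncrossing e′ (≤-trans ℓ≤b (<⇒≤ x<q)) t ≤-refl q<y y<z z<w w<r
                                (trans e′ (trans (sym vb) vx≡vz)) vy≡vw))
  ...     | tri< y<q _ _ with w <? q
  ...       | no w≮q  = contradiction vy≡vw (inside≢outside (s≤s ℓ≤b) e s e′ t x<y y<q (≮⇒≥ w≮q) w<r)
  ...       | yes w<q = contradiction (trans (sym vx≡vz) vb)
                          (inside≢ℓ (s≤s ℓ≤b) e s (<-trans x<y y<z) (<-trans z<w w<q))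

  last-inside : ∀ {b p g q x} → p ≡ suc b → v p ≡ p → Spells v p (suc p) g q → p ≤ x → x < q →
                ∃ λ q′ → q ≡ suc q′ × v q′ ≡ p × odd q′ ≡ not (odd b)
  last-inside {q = suc q′} refl e s _ _ =
    q′ , refl , spells-last e s ,
    trans (sym (not-involutive _)) (trans (cong not (odd-end s)) (cong not (not-involutive _)))

  odd-resume : ∀ {b g q} {ℓ} → Spells v ℓ (suc (suc b)) g q → odd q ≡ odd b
  odd-resume s = trans (odd-end s) (not-involutive _)

  odd-≢ : ∀ {x y} {o : Bool} → odd x ≡ o → odd y ≡ not o → x ≢ y
  odd-≢ ox oy refl = not-¬ (trans (sym oy) ox) refl

  -- Points of one colour in different blocks are separated by a block of the other colour. This is what makes
  -- the primed blocks the coarsest ones.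
  Separation : ℕ → ℕ → ℕ → ℕ → Set
  Separation x y a c = (a < x × x < c × c < y) ⊎ (x < a × a < y × y < c)

  spells-separation : ∀ {ℓ b f r} → odd ℓ ≡ odd b → v b ≡ ℓ → ℓ ≤ b → Spells v ℓ (suc b) f r →
    ∀ {x y} → b ≤ x → x < y → y < r → odd x ≡ odd y → v x ≢ v y →
    ∃₂ λ a c → b ≤ a × c < r × odd a ≡ not (odd x) × v a ≡ v c × Separation x y a c
  spells-separation _ _ _ nil b≤x x<y y<r _ _ = contradiction (<-≤-trans x<y (s≤s⁻¹ y<r)) (≤⇒≯ b≤x)
  spells-separation {ℓ} {b} oℓ vb ℓ≤b (cons {q = q} e s e′ t) {x} {y} b≤x x<y y<r ox≡oy vx≢vy with x <? q
  ... | no x≮q with spells-separation (trans oℓ (sym (odd-resume s))) e′ (≤-trans ℓ≤b b≤q) t (≮⇒≥ x≮q) x<y y<r ox≡oy vx≢vy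
    where b≤q = ≤-trans (n≤1+n _) (≤-trans (n≤1+n _) (spells-≤ s))
  ...   | a , c , q≤a , rest = a , c , ≤-trans (≤-trans (n≤1+n _) (≤-trans (n≤1+n _) (spells-≤ s))) q≤a , rest
  spells-separation {ℓ} {b} oℓ vb ℓ≤b (cons {q = q} e s e′ t) {x} {y} b≤x x<y y<r ox≡oy vx≢vy
      | yes x<q with m≤n⇒m<n∨m≡n b≤x
  ...   | inj₂ refl with <-cmp y q
  ...     | tri≈ _ refl _ = contradiction (trans vb (sym e′)) vx≢vy
  -- Here `q` replaces `x`, whose label it shares. As the pair found starts no earlier than `q`,
  -- only the second kind of separation can arise, and it persists for the smaller `x`.
  ...     | tri> _ _ q<y with spells-separation (trans oℓ (sym (odd-resume s))) e′ (≤-trans ℓ≤b (<⇒≤ x<q)) t ≤-refl q<y y<r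
                                 (trans (odd-resume s) ox≡oy) (λ eq → vx≢vy (trans vb (trans (sym e′) eq)))
  ...       | a , c , q≤a , c<r , oa , va≡vc , inj₁ (a<q , _) = contradiction a<q (≤⇒≯ q≤a)
  ...       | a , c , q≤a , c<r , oa , va≡vc , inj₂ (q<a , a<y , y<c) =
                a , c , ≤-trans b≤x (≤-trans (<⇒≤ x<q) q≤a) , c<r , trans oa (cong not (odd-resume s)) , va≡vc ,
                inj₂ (<-trans x<q q<a , a<y , y<c)
  spells-separation {ℓ} {b} oℓ vb ℓ≤b (cons {q = q} e s e′ t) {x} {y} b≤x x<y y<r ox≡oy vx≢vy
      | yes x<q | inj₂ refl | tri< y<q _ _ with last-inside refl e s x<y y<q
  ...       | q′ , refl , vq′ , oq′ =
                -- The block at the root of the gap has the other colour, starts right after `x` and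
                -- ends right before `q`, so its two ends enclose `y`.
                suc b , q′ , n≤1+n _ , <-≤-trans (n<1+n _) (≤-trans (n≤1+n _) (spells-≤ t)) , refl ,
                trans e (sym vq′) ,
                inj₂ (n<1+n _ , ≤∧≢⇒< x<y (odd-≢ (sym ox≡oy) refl ∘ sym) ,
                      ≤∧≢⇒< (s≤s⁻¹ y<q) (odd-≢ (sym ox≡oy) oq′))
  spells-separation {ℓ} {b} oℓ vb ℓ≤b (cons {q = q} e s e′ t) {x} {y} b≤x x<y y<r ox≡oy vx≢vy
      | yes x<q | inj₁ b<x with y <? q
  ...     | yes y<q with spells-separation refl e ≤-refl s b<x x<y y<q ox≡oy vx≢vy
  ...       | a , c , b<a , c<q , rest = a , c , <⇒≤ b<a , <-≤-trans c<q (≤-trans (n≤1+n _) (spells-≤ t)) , rest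
  -- Now `x` is in the gap and `y` is not. The enclosing pair for `x` is `b` and `q`, or the two
  -- ends of the root block of the gap, whichever has the colour opposite to `x`.
  spells-separation {ℓ} {b} oℓ vb ℓ≤b (cons {q = q} e s e′ t) {x} {y} b≤x x<y y<r ox≡oy vx≢vy
      | yes x<q | inj₁ b<x | no y≮q with odd x ≟ᵇ odd b
  ...       | no ox≢ob = b , q , ≤-refl , spells-≤ t , trans (sym (not-involutive _)) (cong not (sym (¬-not ox≢ob))) ,
                trans vb (sym e′) ,
                inj₁ (b<x , x<q , ≤∧≢⇒< (≮⇒≥ y≮q) λ { refl → ox≢ob (trans ox≡oy (odd-resume s)) })
  ...       | yes ox≡ob with last-inside refl e s b<x x<q
  ...         | q′ , refl , vq′ , oq′ =
                suc b , q′ , n≤1+n _ , <-≤-trans (n<1+n _) (≤-trans (n≤1+n _) (spells-≤ t)) ,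
                cong not (sym ox≡ob) , trans e (sym vq′) ,
                inj₁ (≤∧≢⇒< b<x (odd-≢ ox≡ob refl ∘ sym) , ≤∧≢⇒< (s≤s⁻¹ x<q) (odd-≢ ox≡ob oq′) , ≮⇒≥ y≮q)

-- Labelling a pair of trees

put : ℕ → ℕ → (ℕ → ℕ) → ℕ → ℕ
put p a v x = if does (x ≟ p) then a else v x

put-at : ∀ p a v → put p a v p ≡ a
put-at p a v = cong (if_then a else v p) (dec-true (p ≟ p) refl)

put-other : ∀ p a v {x} → x ≢ p → put p a v x ≡ v x
put-other p a v {x} x≢p = cong (if_then a else v x) (dec-false (x ≟ p) x≢p)

-- Writing proceeds from left to right and each call touches only points from its `p` on, so no
-- label is overwritten later.
spell : (ℕ → ℕ) → ℕ → ℕ → Forest → ℕ → ℕ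
spell v ℓ p nil        = v
spell v ℓ p (cons g f) = spell (put q ℓ (spell (put p p v) p (suc p) g)) ℓ (suc q) f
  where
  q : ℕ
  q = suc p + 2 * size g

spell-below : ∀ v ℓ p f {x} → x < p → spell v ℓ p f x ≡ v x
spell-below v ℓ p nil        x<p = refl
spell-below v ℓ p (cons g f) {x} x<p =
  trans (spell-below _ ℓ (suc q) f (<-trans x<q (n<1+n q)))
    (trans (put-other q ℓ (spell (put p p v) p (suc p) g) (<⇒≢ x<q))
      (trans (spell-below _ p (suc p) g (<-trans x<p (n<1+n p))) (put-other p p v (<⇒≢ x<p))))
  where
  q : ℕ
  q = suc p + 2 * size g
  x<q : x < q
  x<q = <-trans x<p (m≤m+n (suc p) (2 * size g))

spells-cong : ∀ {v w ℓ p f r} → (∀ {x} → p ≤ x → x < r → v x ≡ w x) → Spells v ℓ p f r → Spells w ℓ p f r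
spells-cong v≗w nil = nil
spells-cong {p = p} v≗w (cons {q = q} e s e′ t) =
  cons (trans (sym (v≗w ≤-refl (≤-trans (spells-≤ s) (<⇒≤ q<r)))) e)
    (spells-cong (λ a b → v≗w (<⇒≤ a) (<-trans b q<r)) s)
    (trans (sym (v≗w p≤q q<r)) e′)
    (spells-cong (λ a b → v≗w (≤-trans p≤q (<⇒≤ a)) b) t)
  where
  q<r = spells-≤ t
  p≤q = <⇒≤ (spells-≤ s)

spell-spells : ∀ v ℓ p f → Spells (spell v ℓ p f) ℓ p f (p + 2 * size f)
spell-spells v ℓ p nil        = subst (Spells v ℓ p nil) (sym (+-identityʳ p)) nil
spell-spells v ℓ p (cons g f) = subst (Spells _ ℓ p (cons g f)) (rearrange p (size g) (size f))
  (cons (trans (unchanged p<q) (trans (spell-below _ p (suc p) g (n<1+n p)) (put-at p p v)))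
    (spells-cong (λ _ x<q → sym (unchanged x<q)) (spell-spells (put p p v) p (suc p) g))
    (trans (spell-below _ ℓ (suc q) f (n<1+n q)) (put-at q ℓ (spell (put p p v) p (suc p) g)))
    (spell-spells _ ℓ (suc q) f))
  where
  q : ℕ
  q = suc p + 2 * size g
  p<q : p < q
  p<q = m≤m+n (suc p) (2 * size g)
  unchanged : ∀ {x} → x < q → spell v ℓ p (cons g f) x ≡ spell (put p p v) p (suc p) g x
  unchanged x<q =
      trans (spell-below _ ℓ (suc q) f (<-trans x<q (n<1+n q))) (put-other q ℓ (spell (put p p v) p (suc p) g) (<⇒≢ x<q))
  rearrange : ∀ p a b → suc (suc p + 2 * a) + 2 * b ≡ p + 2 * suc (a + b)
  rearrange = solve-∀

abstract
  labels : Forest → Forest → ℕ → ℕ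
  -- The default label 0 survives at the point 0, below all writes, and makes it the first point of
  -- its block.
  labels g h = spell (put s s (spell (λ _ → 0) 0 1 g)) s (suc s) h
    where
    s : ℕ
    s = suc (2 * size g)

  labels-spelling : ∀ g h → Spelling (labels g h) (2 * suc (size g + size h)) g h
  labels-spelling g h = spelling
    (trans (unchanged (s≤s z≤n)) (spell-below _ 0 1 g (s≤s z≤n)))
    (spells-cong (λ _ x<s → sym (unchanged x<s)) (spell-spells _ 0 1 g))
    (trans (spell-below _ s (suc s) h (n<1+n s)) (put-at s s (spell (λ _ → 0) 0 1 g)))
    (subst (Spells _ s (suc s) h) (rearrange (size g) (size h)) (spell-spells _ s (suc s) h))
    where
    s : ℕ
    s = suc (2 * size g)
    unchanged : ∀ {x} → x < s → labels g h x ≡ spell (λ _ → 0) 0 1 g x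
    unchanged x<s =
        trans (spell-below _ s (suc s) h (<-trans x<s (n<1+n s))) (put-other s s (spell (λ _ → 0) 0 1 g) (<⇒≢ x<s))
    rearrange : ∀ a b → suc (suc (2 * a)) + 2 * b ≡ 2 * suc (a + b)
    rearrange = solve-∀

-- Block sizes and arities

count : (ℕ → ℕ) → ℕ → ℕ → ℕ
count v z zero = 0
count v z (suc n) with v n ≟ z
... | yes _ = suc (count v z n)
... | no  _ = count v z n

module _ {v : ℕ → ℕ} where

  count-yes : ∀ {z n} → v n ≡ z → count v z (suc n) ≡ suc (count v z n)
  count-yes {z} {n} e with v n ≟ z
  ... | yes _ = refl
  ... | no ¬e = contradiction e ¬e

  count-no : ∀ {z n} → v n ≢ z → count v z (suc n) ≡ count v z n
  count-no {z} {n} ¬e with v n ≟ z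
  ... | yes e = contradiction e ¬e
  ... | no _  = refl

  count-none : ∀ {z p} r → p ≤ r → (∀ {x} → p ≤ x → x < r → v x ≢ z) → count v z r ≡ count v z p
  count-none zero    z≤n none = refl
  count-none (suc r) p≤r none with m≤n⇒m<n∨m≡n p≤r
  ... | inj₂ refl = refl
  ... | inj₁ p<r  =
      trans (count-no (none (s≤s⁻¹ p<r) ≤-refl)) (count-none r (s≤s⁻¹ p<r) (λ a b → none a (m≤n⇒m≤1+n b)))

  count-spells : ∀ {ℓ p f r} → ℓ < p → Spells v ℓ p f r → count v ℓ r ≡ width f + count v ℓ p
  count-spells ℓ<p nil = refl
  count-spells {ℓ} {p} ℓ<p (cons {q = q} {g = g} {f} e s e′ t) = begin
    _                             ≡⟨ count-spells (<-trans ℓ<p (<-trans p<q (n<1+n q))) t ⟩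
    width f + count v ℓ (suc q)   ≡⟨ cong (width f +_) (count-yes e′) ⟩
    width f + suc (count v ℓ q)   ≡⟨ +-suc (width f) _ ⟩
    suc (width f + count v ℓ q)   ≡⟨ cong (λ x → suc (width f + x)) (count-none q (<⇒≤ p<q) (inside≢ℓ ℓ<p e s)) ⟩
    suc (width f + count v ℓ p)   ∎
    where
    open ≡-Reasoning
    p<q = spells-≤ s

  -- The block consists of `p` and of one closing point for each child.
  count-node : ∀ {p g q N} → v p ≡ p → Spells v p (suc p) g q → q ≤ N →
               (∀ {x} → x < N → v x ≡ p → p ≤ x × x < q) → count v p N ≡ suc (width g)
  count-node {p} {g} {q} {N} e s q≤N occurs = begin
    count v p N                    ≡⟨ count-none N q≤N (λ q≤x x<N vx → <⇒≱ (proj₂ (occurs x<N vx)) q≤x) ⟩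
    count v p q                    ≡⟨ count-spells (n<1+n p) s ⟩
    width g + count v p (suc p)    ≡⟨ cong (width g +_) (count-yes e) ⟩
    width g + suc (count v p p)
      ≡⟨ cong (λ x → width g + suc x) (count-none p z≤n (λ _ x<p vx → <⇒≱ x<p (proj₁ (occurs (<-trans x<p p<N) vx)))) ⟩
    width g + 1                    ≡⟨ +-comm (width g) 1 ⟩
    suc (width g)                  ∎
    where
    open ≡-Reasoning
    p<N = ≤-trans (spells-≤ s) q≤N

  -- Block sizes are counted over all points below `N`, while the induction sees one interval; this
  -- invariant keeps the labels of the interval from recurring outside it.
  Confined : ℕ → ℕ → ℕ → Set
  Confined N p r = ∀ {x} → x < N → p ≤ v x → v x < r → p ≤ x × x < r

  module _ {ℓ p g q f r N} (ℓ<p : ℓ < p) (e : v p ≡ p) (s : Spells v p (suc p) g q) (e′ : v q ≡ ℓ)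
           (t : Spells v ℓ (suc q) f r) (C : Confined N p r) where

    private
      p<q = spells-≤ s
      q<r = spells-≤ t

      small : ∀ {x} → x < N → p ≤ v x → v x < q → p ≤ x × x < q
      small {x} x<N a b with C x<N a (<-trans b q<r) | x <? q
      ... | c , d | yes x<q = c , x<q
      ... | c , d | no x≮q with outside-label e′ t (≮⇒≥ x≮q) d
      ...   | inj₁ vx≡ℓ = contradiction a (<⇒≱ (≤-<-trans (≤-reflexive vx≡ℓ) ℓ<p))
      ...   | inj₂ q<vx = contradiction b (<-asym q<vx)

    confined-inner : Confined N (suc p) q
    confined-inner x<N a b with small x<N (<⇒≤ a) b
    ... | c , d = ≤∧≢⇒< c (λ { refl → <-irrefl (sym e) a }) , d

    confined-outer : Confined N (suc q) r
    confined-outer {x} x<N a b with C x<N (≤-trans (<⇒≤ p<q) (<⇒≤ a)) b | x <? q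
    ... | c , d | yes x<q = contradiction (proj₂ (inside-label e s c x<q)) (<-asym a)
    ... | c , d | no x≮q  =
      ≤∧≢⇒< (≮⇒≥ x≮q) (λ { refl → <-irrefl refl (<-trans (<-trans p<q a) (≤-<-trans (≤-reflexive e′) ℓ<p)) }) , d

    occurs-inside : ∀ {x} → x < N → v x ≡ p → p ≤ x × x < q
    occurs-inside x<N vx = small x<N (≤-reflexive (sym vx)) (≤-<-trans (≤-reflexive vx) p<q)

  BlockCounts : ℕ → ℕ → ℕ → ℕ → Set
  BlockCounts d N p r = ∀ {x} → p ≤ x → x < r → v x ≡ x → count v x N ≡ 1 ⊎ count v x N ≡ suc d

  as-width : ∀ {d c w} → c ≡ suc w → c ≡ 1 ⊎ c ≡ suc d → w ≡ 0 ⊎ w ≡ d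
  as-width refl (inj₁ a) = inj₁ (suc-injective a)
  as-width refl (inj₂ a) = inj₂ (suc-injective a)

  as-count : ∀ {d c w} → c ≡ suc w → w ≡ 0 ⊎ w ≡ d → c ≡ 1 ⊎ c ≡ suc d
  as-count refl (inj₁ refl) = inj₁ refl
  as-count refl (inj₂ refl) = inj₂ refl

  counts⇒arities : ∀ {d N ℓ p f r} → r ≤ N → ℓ < p → Spells v ℓ p f r → Confined N p r → BlockCounts d N p r →
                   Arities d f
  counts⇒arities r≤N ℓ<p nil C B = nil
  counts⇒arities {p = p} r≤N ℓ<p (cons {q = q} e s e′ t) C B =
    cons (as-width (count-node e s q≤N (occurs-inside ℓ<p e s e′ t C)) (B ≤-refl (<-trans p<q q<r) e))
      (counts⇒arities q≤N ≤-refl s (confined-inner ℓ<p e s e′ t C) (λ a b → B (<⇒≤ a) (<-trans b q<r)))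
      (counts⇒arities r≤N (<-trans ℓ<p (<-trans p<q (n<1+n q))) t (confined-outer ℓ<p e s e′ t C)
        (λ a → B (≤-trans (<⇒≤ p<q) (<⇒≤ a))))
    where
    p<q = spells-≤ s
    q<r = spells-≤ t
    q≤N = ≤-trans (<⇒≤ q<r) r≤N

  arities⇒counts : ∀ {d N ℓ p f r} → r ≤ N → ℓ < p → Spells v ℓ p f r → Confined N p r → Arities d f →
                   BlockCounts d N p r
  arities⇒counts r≤N ℓ<p nil C A p≤x x<r = contradiction x<r (≤⇒≯ p≤x)
  arities⇒counts {p = p} r≤N ℓ<p (cons {q = q} e s e′ t) C (cons w A A′) p≤x x<r vx with region {q = q} p≤x x<r
  ... | at-p refl     = as-count (count-node e s (≤-trans (<⇒≤ (spells-≤ t)) r≤N) (occurs-inside ℓ<p e s e′ t C)) w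
  ... | inside a b    =
      arities⇒counts (≤-trans (<⇒≤ (spells-≤ t)) r≤N) ≤-refl s (confined-inner ℓ<p e s e′ t C) A a b vx
  ... | at-q refl     = contradiction (trans (sym e′) vx) (<⇒≢ (<-trans ℓ<p (spells-≤ s)))
  ... | after a b     =
      arities⇒counts r≤N (<-trans ℓ<p (<-trans (spells-≤ s) (n<1+n q))) t (confined-outer ℓ<p e s e′ t C) A′ a b vx

  -- Labels inside a gap exceed `ℓ`, so the gap must end at the next point labelled `ℓ`.
  spells-unique : ∀ {ℓ p f f′ r} → ℓ < p → Spells v ℓ p f r → Spells v ℓ p f′ r → f ≡ f′
  spells-unique ℓ<p nil nil = refl
  spells-unique ℓ<p nil (cons _ s _ t) = contradiction (<-trans (spells-≤ s) (spells-≤ t)) (<-irrefl refl)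
  spells-unique ℓ<p (cons _ s _ t) nil = contradiction (<-trans (spells-≤ s) (spells-≤ t)) (<-irrefl refl)
  spells-unique ℓ<p (cons {q = q} e s a t) (cons {q = q′} _ s′ a′ t′) with <-cmp q q′
  ... | tri< q<q′ _ _ = contradiction a (inside≢ℓ ℓ<p e s′ (<⇒≤ (spells-≤ s)) q<q′)
  ... | tri> _ _ q′<q = contradiction a′ (inside≢ℓ ℓ<p e s (<⇒≤ (spells-≤ s′)) q′<q)
  ... | tri≈ _ refl _ =
      cong₂ cons (spells-unique ≤-refl s s′) (spells-unique (<-trans ℓ<p (<-trans (spells-≤ s) (n<1+n q))) t t′)

  -- Properties of the labelling of a pair of trees

  module _ {N g h} (S : Spelling v N g h) where
    open Spelling S

    0<split : 0 < split
    0<split = spells-≤ first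

    split<N : split < N
    split<N = spells-≤ second

    low-label : ∀ {x} → x < split → v x < split
    low-label x<s = proj₂ (inside-label start first z≤n x<s)

    high-label : ∀ {x} → split ≤ x → x < N → split ≤ v x
    high-label s≤x x<N = proj₁ (inside-label middle second s≤x x<N)

    label-≤ : ∀ {x} → x < N → v x ≤ x × v (v x) ≡ v x
    label-≤ {zero}  _   = ≤-reflexive start , cong v start
    label-≤ {suc x} x<N with <-cmp (suc x) split
    ... | tri≈ _ e _ =
        ≤-reflexive (trans (cong v e) (trans middle (sym e))) , cong v (trans (cong v e) (trans middle (sym e)))
    ... | tri< a _ _ with spells-range first (s≤s z≤n) a
    ...   | inj₁ e           = subst (_≤ suc x) (sym e) z≤n , trans (cong v e) (trans start (sym e))
    ...   | inj₂ (_ , b , c) = b , c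
    label-≤ {suc x} x<N | tri> _ _ a with spells-range second a x<N
    ...   | inj₁ e           = subst (_≤ suc x) (sym e) (<⇒≤ a) , trans (cong v e) (trans middle (sym e))
    ...   | inj₂ (_ , b , c) = b , c

    label-odd : ∀ {x} → x < N → odd (v x) ≡ odd x
    label-odd {zero}  _   = cong odd start
    label-odd {suc x} x<N with <-cmp (suc x) split
    ... | tri≈ _ e _ = cong odd (trans (cong v e) (trans middle (sym e)))
    ... | tri< a _ _ = spells-odd refl first (s≤s z≤n) a
    ... | tri> _ _ a = spells-odd refl second a x<N

    label-noncrossing : ∀ {x y z w} → x < y → y < z → z < w → w < N → v x ≡ v z → v y ≡ v w → v x ≡ v y
    label-noncrossing {x} {y} {z} {w} x<y y<z z<w w<N vx≡vz vy≡vw with x <? split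
    ... | no x≮s = spells-noncrossing middle ≤-refl second (≮⇒≥ x≮s) x<y y<z z<w w<N vx≡vz vy≡vw
    ... | yes x<s with w <? split
    ...   | yes w<s = spells-noncrossing start z≤n first z≤n x<y y<z z<w w<s vx≡vz vy≡vw
    ...   | no w≮s with z <? split
    ...     | no z≮m  =
        contradiction (subst (_< split) vx≡vz (low-label x<s)) (≤⇒≯ (high-label (≮⇒≥ z≮m) (<-trans z<w w<N)))
    ...     | yes z<m =
        contradiction (subst (_< split) vy≡vw (low-label (<-trans y<z z<m))) (≤⇒≯ (high-label (≮⇒≥ w≮s) w<N))

    label-separation : ∀ {x y} → x < y → y < N → odd x ≡ true → odd y ≡ true → v x ≢ v y →
                       ∃₂ λ a c → c < N × odd a ≡ false × v a ≡ v c × Separation {v} x y a c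
    label-separation {x} {y} x<y y<N ox oy vx≢vy with x <? split
    ... | no x≮s with spells-separation refl middle ≤-refl second (≮⇒≥ x≮s) x<y y<N (trans ox (sym oy)) vx≢vy
    ...   | a , c , _ , c<N , oa , rest = a , c , c<N , trans oa (cong not ox) , rest
    label-separation {x} {y} x<y y<N ox oy vx≢vy | yes x<s with y <? split
    ...   | yes y<s with spells-separation refl start z≤n first z≤n x<y y<s (trans ox (sym oy)) vx≢vy
    ...     | a , c , _ , c<s , oa , rest = a , c , <-trans c<s split<N , trans oa (cong not ox) , rest
    label-separation {x} {y} x<y y<N ox oy vx≢vy | yes x<s | no y≮s = gap split refl
      where
      gap : ∀ s → s ≡ split → ∃₂ λ a c → c < N × odd a ≡ false × v a ≡ v c × Separation {v} x y a c
      gap zero     e = contradiction 0<split (<-irrefl e)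
      -- The points lie in different trees, and the block of 1, which runs from 0 to `s′`, encloses
      -- `x` and leaves `y` outside.
      gap (suc s′) refl = 0 , s′ , <-trans (n<1+n s′) split<N , refl , trans start (sym vs′) ,
        inj₁ (≢0⇒> ox ,
              ≤∧≢⇒< (s≤s⁻¹ x<s) (λ { refl → contradiction (trans (sym (odd-end first)) (cong not ox)) λ () }) ,
              ≮⇒≥ y≮s)
        where
        vs′ : v s′ ≡ 0
        vs′ = spells-last start first
        ≢0⇒> : ∀ {n} → odd n ≡ true → 0 < n
        ≢0⇒> {suc n} _ = s≤s z≤n

    count-first : count v 0 N ≡ suc (width g)
    count-first = count-node start first (<⇒≤ split<N) occurs
      where
      occurs : ∀ {x} → x < N → v x ≡ 0 → 0 ≤ x × x < split
      occurs {x} x<N vx with x <? split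
      ... | yes x<s = z≤n , x<s
      ... | no x≮s  = contradiction 0<split (≤⇒≯ (subst (split ≤_) vx (high-label (≮⇒≥ x≮s) x<N)))

    private
      confined-first : Confined N 1 split
      confined-first {x} x<N a b with x <? split
      ... | no x≮s  = contradiction b (≤⇒≯ (high-label (≮⇒≥ x≮s) x<N))
      ... | yes x<s = ≤∧≢⇒< z≤n (λ { refl → <-irrefl (sym start) a }) , x<s

      confined-second : Confined N (suc split) N
      confined-second {x} x<N a b with x <? split
      ... | yes x<s = contradiction (low-label x<s) (<-asym a)
      ... | no x≮s  = ≤∧≢⇒< (≮⇒≥ x≮s) (λ { refl → <-irrefl (sym middle) a }) , x<N

      count-second : count v split N ≡ suc (width h)
      count-second = count-node middle second ≤-refl occurs
        where
        occurs : ∀ {x} → x < N → v x ≡ split → split ≤ x × x < N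
        occurs {x} x<N vx with x <? split
        ... | yes x<s = contradiction (low-label x<s) (<-irrefl vx)
        ... | no x≮s  = ≮⇒≥ x≮s , x<N

    labels⇒arities : ∀ {d} → BlockCounts d N 0 N → Arities d (cons g (cons h nil))
    labels⇒arities B =
      cons (as-width count-first (B z≤n (<-trans 0<split split<N) start))
        (counts⇒arities (<⇒≤ split<N) (s≤s z≤n) first confined-first (λ a b → B z≤n (<-trans b split<N)))
        (cons (as-width count-second (B z≤n split<N middle))
          (counts⇒arities ≤-refl ≤-refl second confined-second (λ a b → B z≤n b)) nil)

    arities⇒labels : ∀ {d} → Arities d (cons g (cons h nil)) → BlockCounts d N 0 N
    arities⇒labels (cons wg Ag (cons wh Ah nil)) {zero}  _ x<N vx = as-count count-first wg
    arities⇒labels (cons wg Ag (cons wh Ah nil)) {suc x} _ x<N vx with <-cmp (suc x) split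
    ... | tri≈ _ e _ = as-count (trans (cong (λ y → count v y N) e) count-second) wh
    ... | tri< a _ _ = arities⇒counts (<⇒≤ split<N) (s≤s z≤n) first confined-first Ag (s≤s z≤n) a vx
    ... | tri> _ _ a = arities⇒counts ≤-refl ≤-refl second confined-second Ah a x<N vx

    last-low : ∃ λ t → split ≡ suc t × v t ≡ 0
    last-low with split in eq | first
    ... | zero  | s = contradiction (spells-≤ s) λ ()
    ... | suc t | s = t , refl , spells-last start s

  -- The point before the later split is labelled 0, yet it would belong to the second tree of the
  -- other spelling, where labels are positive.
  split-≮ : ∀ {N g h g′ h′} (S : Spelling v N g h) (S′ : Spelling v N g′ h′) → ¬ Spelling.split S < Spelling.split S′
  split-≮ S S′ a with last-low S′
  ... | t , e , vt = <⇒≱ (0<split S) (subst (Spelling.split S ≤_) vt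
                       (high-label S (s≤s⁻¹ (subst (Spelling.split S <_) e a))
                         (<-trans (subst (t <_) (sym e) (n<1+n t)) (split<N S′))))

  spelling-unique : ∀ {N g h g′ h′} → Spelling v N g h → Spelling v N g′ h′ → g ≡ g′ × h ≡ h′
  spelling-unique S S′ with <-cmp (Spelling.split S) (Spelling.split S′)
  ... | tri< a _ _    = contradiction a (split-≮ S S′)
  ... | tri> _ _ a    = contradiction a (split-≮ S′ S)
  ... | tri≈ _ refl _ = spells-unique (s≤s z≤n) (Spelling.first S) (Spelling.first S′) ,
                        spells-unique ≤-refl (Spelling.second S) (Spelling.second S′)

-- The partition and its dual from a labelling

2*suc : ∀ m → 2 * suc m ≡ suc (suc (2 * m))
2*suc m = cong suc (+-suc m (m + 0))

odd-2* : ∀ m → odd (2 * m) ≡ false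
odd-2* = odd-n+2*m 0

2*-cancel : ∀ {a b} → 2 * a ≡ 2 * b → a ≡ b
2*-cancel = *-cancelˡ-≡ _ _ 2

2*-mono-< : ∀ {a b} → a < b → 2 * a < 2 * b
2*-mono-< = *-monoʳ-< 2

2*-mono-≤ : ∀ {a b} → a ≤ b → 2 * a ≤ 2 * b
2*-mono-≤ = *-monoʳ-≤ 2

2*-cancel-< : ∀ {a b} → 2 * a < 2 * b → a < b
2*-cancel-< = *-cancelˡ-< 2 _ _

2*-cancel-≤ : ∀ {a b} → 2 * a ≤ 2 * b → a ≤ b
2*-cancel-≤ = *-cancelˡ-≤ 2

odd<even : ∀ {a n} → a < n → suc (2 * a) < 2 * n
odd<even {a} {n} a<n = subst (_≤ 2 * n) (2*suc a) (2*-mono-≤ a<n)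

data Point {n : ℕ} : ℕ → Set where
  unprimed : (i : Fin n) → Point (2 * toℕ i)
  primed   : (i : Fin n) → Point (suc (2 * toℕ i))

point : ∀ {n x} → x < 2 * n → Point {n} x
point {suc n} {zero}        _ = unprimed zero
point {suc n} {suc zero}    _ = primed zero
point {suc n} {suc (suc x)} x< with point {n} {x} (s≤s⁻¹ (s≤s⁻¹ (subst (suc (suc (suc x)) ≤_) (2*suc n) x<)))
... | unprimed i = subst Point (2*suc (toℕ i)) (unprimed (suc i))
... | primed i   = subst Point (cong suc (2*suc (toℕ i))) (primed (suc i))

abstract
  kernel : ∀ {n} → (ℕ → ℕ) → Rel n
  kernel u = tabulate λ i → tabulate λ j → u (toℕ i) ≡ᵇ u (toℕ j)

  kernel-⇔ : ∀ {n} (u : ℕ → ℕ) (i j : Fin n) → (i ∼[ kernel u ] j) ⇔ (u (toℕ i) ≡ u (toℕ j))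
  kernel-⇔ {n} u i j = mk⇔
    (λ r → ≡ᵇ⇒≡ _ _ (from T-≡ (trans (sym entry) r)))
    (λ e → trans entry (to T-≡ (≡⇒≡ᵇ _ _ e)))
    where
    row : Fin n → Vec Bool n
    row i = tabulate λ j → u (toℕ i) ≡ᵇ u (toℕ j)
    entry : lookup (lookup (kernel u) i) j ≡ (u (toℕ i) ≡ᵇ u (toℕ j))
    entry = trans (cong (λ r → lookup r j) (lookup∘tabulate row i)) (lookup∘tabulate (λ j → u (toℕ i) ≡ᵇ u (toℕ j)) j)

kernel-partition : ∀ {n} {R : Rel n} (u : ℕ → ℕ) → (∀ i j → (i ∼[ R ] j) ⇔ (u (toℕ i) ≡ u (toℕ j))) → IsPartition R
kernel-partition u R⇔ = record
  { refl  = λ i → from (R⇔ i i) refl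
  ; sym   = λ i j r → from (R⇔ j i) (sym (to (R⇔ i j) r))
  ; trans = λ i j l r s → from (R⇔ i l) (trans (to (R⇔ i j) r) (to (R⇔ j l) s))
  }

record Labelled {n : ℕ} (v : ℕ → ℕ) (π σ : Rel n) : Set where
  field
    unprimed⇔ : ∀ i j → (i ∼[ π ] j) ⇔ (v (2 * toℕ i) ≡ v (2 * toℕ j))
    primed⇔   : ∀ i j → (i ∼[ σ ] j) ⇔ (v (suc (2 * toℕ i)) ≡ v (suc (2 * toℕ j)))

kernel-labelled : ∀ {n} v → Labelled {n} v (kernel (λ i → v (2 * i))) (kernel (λ i → v (suc (2 * i))))
kernel-labelled v = record { unprimed⇔ = kernel-⇔ (λ i → v (2 * i)) ; primed⇔ = kernel-⇔ (λ i → v (suc (2 * i))) }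

module _ {n : ℕ} {π σ : Rel n} where

  combined-odd : ∀ {x y} → Combined π σ x y → odd x ≡ odd y
  combined-odd (unprimed i j _) = trans (odd-2* (toℕ i)) (sym (odd-2* (toℕ j)))
  combined-odd (primed i j _)   = cong not (trans (odd-2* (toℕ i)) (sym (odd-2* (toℕ j))))

  module _ {v} (L : Labelled v π σ) where
    open Labelled L

    combined⇒≡ : ∀ {x y} → Combined π σ x y → v x ≡ v y
    combined⇒≡ (unprimed i j r) = to (unprimed⇔ i j) r
    combined⇒≡ (primed i j r)   = to (primed⇔ i j) r

    ≡⇒combined : ∀ {x y} → x < 2 * n → y < 2 * n → odd x ≡ odd y → v x ≡ v y → Combined π σ x y
    ≡⇒combined x<N y<N o e with point {n} x<N | point {n} y<N
    ... | unprimed i | unprimed j = unprimed i j (from (unprimed⇔ i j) e)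
    ... | primed i   | primed j   = primed i j (from (primed⇔ i j) e)
    ... | unprimed i | primed j   =
        contradiction (trans (sym (odd-2* (toℕ i))) (trans o (cong not (odd-2* (toℕ j))))) λ ()
    ... | primed i   | unprimed j =
        contradiction (trans (sym (odd-2* (toℕ j))) (trans (sym o) (cong not (odd-2* (toℕ i))))) λ ()

-- An entry of the row stands for two neighbouring points, at most one of which has label `z`. In
-- this form the count serves the rows of π and of σ alike.
trues-count : ∀ {v z m} p (row : Vec Bool m) →
  (∀ j → (lookup row j ≡ true) ⇔ (v (p + 2 * toℕ j) ≡ z ⊎ v (suc (p + 2 * toℕ j)) ≡ z)) →
  (∀ (j : Fin m) → v (p + 2 * toℕ j) ≡ z → v (suc (p + 2 * toℕ j)) ≢ z) →
  count v z (p + 2 * m) ≡ trues row + count v z p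
trues-count {v} {z} p [] _ _ = cong (count v z) (+-identityʳ p)
trues-count {v} {z} {suc m} p (b ∷ row) row⇔ excl = begin
  count v z (p + 2 * suc m)                  ≡⟨ cong (count v z) (shift m) ⟩
  count v z (suc (suc p) + 2 * m)            ≡⟨ trues-count {v} (suc (suc p)) row row⇔′ excl′ ⟩
  trues row + count v z (suc (suc p))        ≡⟨ head b (row⇔ zero) (excl zero) ⟩
  trues (b ∷ row) + count v z p              ∎
  where
  open ≡-Reasoning
  shift : ∀ m → p + 2 * suc m ≡ suc (suc p) + 2 * m
  shift m = trans (cong (p +_) (2*suc m)) (trans (+-suc p _) (cong suc (+-suc p _)))
  row⇔′ : ∀ j → (lookup row j ≡ true) ⇔ (v (suc (suc p) + 2 * toℕ j) ≡ z ⊎ v (suc (suc (suc p) + 2 * toℕ j)) ≡ z)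
  row⇔′ j = subst (λ x → (lookup row j ≡ true) ⇔ (v x ≡ z ⊎ v (suc x) ≡ z)) (shift (toℕ j)) (row⇔ (suc j))
  excl′ : ∀ j → v (suc (suc p) + 2 * toℕ j) ≡ z → v (suc (suc (suc p) + 2 * toℕ j)) ≢ z
  excl′ j = subst (λ x → v x ≡ z → v (suc x) ≢ z) (shift (toℕ j)) (excl (suc j))
  head : ∀ b → (b ≡ true) ⇔ (v (p + 0) ≡ z ⊎ v (suc (p + 0)) ≡ z) → (v (p + 0) ≡ z → v (suc (p + 0)) ≢ z) →
         trues row + count v z (suc (suc p)) ≡ trues (b ∷ row) + count v z p
  head b h x rewrite +-identityʳ p with v p ≟ z in ep | v (suc p) ≟ z in eq | b
  ... | yes a | yes c | _     = contradiction c (x a)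
  ... | yes a | no ¬c | true  rewrite ep = +-suc _ _
  ... | yes a | no ¬c | false = contradiction (from h (inj₁ a)) λ ()
  ... | no ¬a | yes c | true  rewrite ep = +-suc _ _
  ... | no ¬a | yes c | false = contradiction (from h (inj₂ c)) λ ()
  ... | no ¬a | no ¬c | false rewrite ep = refl
  ... | no ¬a | no ¬c | true  = [ (λ a → contradiction a ¬a) , (λ c → contradiction c ¬c) ]′ (to h refl)

module _ {n : ℕ} {π σ : Rel n} {v g h} (L : Labelled v π σ) (S : Spelling v (2 * n) g h) where
  open Labelled L

  private
    even<N : ∀ (i : Fin n) → 2 * toℕ i < 2 * n
    even<N i = 2*-mono-< (toℕ<n i)

    odd<N : ∀ (i : Fin n) → suc (2 * toℕ i) < 2 * n
    odd<N i = odd<even (toℕ<n i)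

    ≡⇒odd : ∀ {x y} → x < 2 * n → y < 2 * n → v x ≡ v y → odd x ≡ odd y
    ≡⇒odd x<N y<N e = trans (sym (label-odd S x<N)) (trans (cong odd e) (label-odd S y<N))

    even≢odd-label : ∀ (i j : Fin n) → v (2 * toℕ i) ≢ v (suc (2 * toℕ j))
    even≢odd-label i j e = contradiction
      (trans (sym (odd-2* (toℕ i))) (trans (≡⇒odd (even<N i) (odd<N j) e) (cong not (odd-2* (toℕ j))))) λ ()

  blockSize-unprimed : ∀ i → blockSize π i ≡ count v (v (2 * toℕ i)) (2 * n)
  blockSize-unprimed i = sym (trans
    (trues-count 0 (lookup π i)
      (λ j → mk⇔ (λ r → inj₁ (sym (to (unprimed⇔ i j) r)))
                 [ (λ e → from (unprimed⇔ i j) (sym e)) , (λ e → contradiction (sym e) (even≢odd-label i j)) ]′)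
      (λ j _ e → even≢odd-label i j (sym e)))
    (+-identityʳ _))

  blockSize-primed : ∀ i → blockSize σ i ≡ count v (v (suc (2 * toℕ i))) (2 * n)
  blockSize-primed i = sym (trans
    (trues-count 0 (lookup σ i)
      (λ j → mk⇔ (λ r → inj₂ (sym (to (primed⇔ i j) r)))
                 [ (λ e → contradiction e (even≢odd-label j i)) , (λ e → from (primed⇔ i j) (sym e)) ]′)
      (λ j e _ → even≢odd-label j i e))
    (+-identityʳ _))

  counts⇒sizes : ∀ {d} → BlockCounts {v} d (2 * n) 0 (2 * n) → BlocksOfSize1or d π × BlocksOfSize1or d σ
  counts⇒sizes {d} B =
    (λ i → subst (λ c → c ≡ 1 ⊎ c ≡ suc d) (sym (blockSize-unprimed i)) (at (even<N i))) ,
    (λ i → subst (λ c → c ≡ 1 ⊎ c ≡ suc d) (sym (blockSize-primed i)) (at (odd<N i)))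
    where
    at : ∀ {x} → x < 2 * n → count v (v x) (2 * n) ≡ 1 ⊎ count v (v x) (2 * n) ≡ suc d
    at x<N = B z≤n (≤-<-trans (proj₁ (label-≤ S x<N)) x<N) (proj₂ (label-≤ S x<N))

  sizes⇒counts : ∀ {d} → BlocksOfSize1or d π → BlocksOfSize1or d σ → BlockCounts {v} d (2 * n) 0 (2 * n)
  sizes⇒counts {d} Bπ Bσ _ x<N vx =
      subst (λ z → count v z (2 * n) ≡ 1 ⊎ count v z (2 * n) ≡ suc d) vx (at (point {n} x<N))
    where
    at : ∀ {x} → Point {n} x → count v (v x) (2 * n) ≡ 1 ⊎ count v (v x) (2 * n) ≡ suc d
    at (unprimed i) = subst (λ c → c ≡ 1 ⊎ c ≡ suc d) (blockSize-unprimed i) (Bπ i)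
    at (primed i)   = subst (λ c → c ≡ 1 ⊎ c ≡ suc d) (blockSize-primed i) (Bσ i)

  spelling⇒noncrossing : IsNoncrossingPartition π
  spelling⇒noncrossing = kernel-partition (λ i → v (2 * i)) unprimed⇔ , crossing
    where
    crossing : Noncrossing (λ a b → Σ (Fin n) λ i → Σ (Fin n) λ j → a ≡ toℕ i × b ≡ toℕ j × i ∼[ π ] j) n
    crossing a b c e a<b b<c c<e e<n ((i , j , refl , refl , r) , (i′ , j′ , refl , refl , r′) , ¬s) =
      ¬s (i , i′ , refl , refl , from (unprimed⇔ i i′)
        (label-noncrossing S (2*-mono-< a<b) (2*-mono-< b<c) (2*-mono-< c<e) (2*-mono-< e<n)
          (to (unprimed⇔ i j) r) (to (unprimed⇔ i′ j′) r′)))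

  spelling⇒krewerasDual : IsKrewerasDual π σ
  spelling⇒krewerasDual = record
    { partition   = σ-partition
    ; noncrossing = λ a b c e a<b b<c c<e e<N (s , s′ , ¬s) →
        let vab = label-noncrossing S a<b b<c c<e e<N (combined⇒≡ L s) (combined⇒≡ L s′)
            b<N = <-trans b<c (<-trans c<e e<N)
            a<N = <-trans a<b b<N
        in ¬s (≡⇒combined L a<N b<N (≡⇒odd a<N b<N vab) vab)
    ; coarsest    = coarsest
    }
    where
    σ-partition = kernel-partition (λ i → v (suc (2 * i))) primed⇔

    -- Even points carry blocks of π, which stay the same when σ is replaced by a competitor τ.
    even-pair : ∀ {a c} → a < 2 * n → c < 2 * n → v a ≡ v c → (τ : Rel n) → odd a ≡ false → Combined π τ a c
    even-pair a<N c<N vac τ oa with ≡⇒combined L a<N c<N (≡⇒odd a<N c<N vac) vac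
    ... | unprimed i j r = unprimed i j r
    ... | primed i j r   = contradiction (trans (sym oa) (cong not (odd-2* (toℕ i)))) λ ()

    -- If the labels differed, the separating pair of unprimed points would cross the pair joined by
    -- τ.
    ordered : ∀ (τ : Rel n) → Noncrossing (Combined π τ) (2 * n) → ∀ i j → toℕ i < toℕ j → i ∼[ τ ] j → i ∼[ σ ] j
    ordered τ nc i j i<j r =
        from (primed⇔ i j) (decidable-stable (v x ≟ v y) λ vx≢vy → crossing (label-separation S x<y (odd<N j) ox oy vx≢vy))
      where
      x = suc (2 * toℕ i)
      y = suc (2 * toℕ j)
      x<y : x < y
      x<y = s≤s (2*-mono-< i<j)
      ox : odd x ≡ true
      ox = cong not (odd-2* (toℕ i))
      oy : odd y ≡ true
      oy = cong not (odd-2* (toℕ j))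
      crossing : ¬ ∃₂ λ a c → c < 2 * n × odd a ≡ false × v a ≡ v c × Separation {v} x y a c
      crossing (a , c , c<N , oa , vac , inj₁ (a<x , x<c , c<y)) =
        nc a x c y a<x x<c c<y (odd<N j)
          (even-pair (<-trans a<x (odd<N i)) c<N vac τ oa , primed i j r ,
           λ s → contradiction (trans (sym oa) (trans (combined-odd s) ox)) λ ())
      crossing (a , c , c<N , oa , vac , inj₂ (x<a , a<y , y<c)) =
        nc x a y c x<a a<y y<c c<N
          (primed i j r , even-pair (<-trans a<y (odd<N j)) c<N vac τ oa ,
           λ s → contradiction (trans (sym oa) (trans (sym (combined-odd s)) ox)) λ ())

    coarsest : ∀ (τ : Rel n) → IsPartition τ → Noncrossing (Combined π τ) (2 * n) → ∀ i j → i ∼[ τ ] j → i ∼[ σ ] j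
    coarsest τ pτ nc i j r with <-cmp (toℕ i) (toℕ j)
    ... | tri< i<j _ _ = ordered τ nc i j i<j r
    ... | tri> _ _ j<i = IsPartition.sym σ-partition j i (ordered τ nc j i j<i (IsPartition.sym pτ i j r))
    ... | tri≈ _ e _   = from (primed⇔ i j) (cong (λ x → v (suc (2 * x))) e)

-- A pair of trees from block labels

module _ {P : ℕ → Set} (P? : Decidable P) where

  least : ∀ b n → n ≤ b → P n → ∃ λ m → P m × m ≤ n × (∀ {k} → P k → m ≤ k)
  least b n n≤b p with anyUpTo? P? n
  ... | no none = n , p , ≤-refl , λ {k} q → ≮⇒≥ λ k<n → none (k , k<n , q)
  least zero    n n≤0 p | yes (k , k<n , q) = contradiction (≤-trans k<n n≤0) λ ()
  least (suc b) n n≤b p | yes (k , k<n , q) with least b k (s≤s⁻¹ (≤-trans k<n n≤b)) q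
  ... | m , pm , m≤k , min = m , pm , ≤-trans m≤k (<⇒≤ k<n) , min

  greatest : ∀ n {m} → m < n → P m → ∃ λ g → m ≤ g × g < n × P g × (∀ {k} → k < n → P k → k ≤ g)
  greatest (suc n) {m} m<n p with P? n
  ... | yes q = n , s≤s⁻¹ m<n , ≤-refl , q , λ k<n _ → s≤s⁻¹ k<n
  ... | no ¬q with greatest n (≤∧≢⇒< (s≤s⁻¹ m<n) λ { refl → ¬q p }) p
  ...   | g , m≤g , g<n , pg , max =
          g , m≤g , m<n⇒m<1+n g<n , pg , λ k<n pk → max (≤∧≢⇒< (s≤s⁻¹ k<n) λ { refl → ¬q pk }) pk

record BlockLabels (N : ℕ) (v : ℕ → ℕ) : Set where
  field
    v≤          : ∀ x → v x ≤ x
    idem        : ∀ x → v (v x) ≡ v x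
    same-parity : ∀ {x y} → v x ≡ v y → odd x ≡ odd y
    noncrossing : ∀ {x y z w} → x < y → y < z → z < w → w < N → v x ≡ v z → v y ≡ v w → v x ≡ v y
    -- Excepted is the block of 1, whose last point is followed by the first point of the block of n′.
    closing     : ∀ {x} → suc x < N → (∀ {y} → x < y → y < N → v y ≢ v x) → v x ≢ 0 → v (suc x) ≢ suc x

module _ {N : ℕ} {v : ℕ → ℕ} (B : BlockLabels N v) where
  open BlockLabels B

  -- Otherwise the block of `suc x`, of the other colour, also has a point before `x`, and crosses
  -- the block that joins `x` to `y`.
  fresh-after-nonlast : ∀ {x y} → x < y → y < N → v y ≡ v x → v (suc x) ≡ suc x
  fresh-after-nonlast {x} {y} x<y y<N vy≡vx with m≤n⇒m<n∨m≡n (v≤ (suc x))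
  ... | inj₂ e = e
  ... | inj₁ u<sx = contradiction (trans (sym (same-parity vu≡vx)) ou) (not-¬ refl)
    where
    u = v (suc x)
    ou : odd u ≡ not (odd x)
    ou = same-parity (idem (suc x))
    u≢x : u ≢ x
    u≢x e = not-¬ refl (trans (cong odd (sym e)) ou)
    y≢sx : suc x ≢ y
    y≢sx refl = not-¬ refl (sym (same-parity vy≡vx))
    vu≡vx : v u ≡ v x
    vu≡vx = noncrossing (≤∧≢⇒< (s≤s⁻¹ u<sx) u≢x) (n<1+n x) (≤∧≢⇒< x<y y≢sx) y<N (idem (suc x)) (sym vy≡vx)

  NoneFrom : ℕ → ℕ → Set
  NoneFrom ℓ r = ∀ {y} → r ≤ y → y < N → v y ≢ ℓ

  -- A block that begins between `ℓ` and `r` and is met again at `suc r` would cross the block of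
  -- `ℓ`, which ends at `r`.
  older : ∀ {ℓ f r} → v ℓ ≡ ℓ → Spells v ℓ (suc ℓ) f (suc r) → NoneFrom ℓ (suc r) → suc r < N →
          v (suc r) ≢ suc r → v (suc r) < ℓ
  older {ℓ} {f} {r} e s none r<N stale with v (suc r) <? ℓ
  ... | yes a = a
  ... | no ¬a =
      contradiction (noncrossing (≤∧≢⇒< (≮⇒≥ ¬a) (u≢ℓ ∘ sym)) u<r (n<1+n r) r<N (trans e (sym vr)) (idem (suc r)))
                  (λ e′ → u≢ℓ (trans (sym (idem (suc r))) (trans (sym e′) e)))
    where
    vr : v r ≡ ℓ
    vr = spells-last e s
    u≢ℓ : v (suc r) ≢ ℓ
    u≢ℓ = none ≤-refl r<N
    u<r : v (suc r) < r
    u<r = ≤∧≢⇒< (s≤s⁻¹ (≤∧≢⇒< (v≤ (suc r)) stale)) (λ e′ → u≢ℓ (trans (sym (idem (suc r))) (trans (cong v e′) vr)))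

  -- By `closing`, no new block opens after the one that starts at `suc x`, so `suc r` continues a
  -- block with a point at or before `x`. Since the block of `ℓ` still has the point `y` ahead, any
  -- other such block would cross it.
  resumed : ∀ {ℓ x y g r} → v x ≡ ℓ → x < y → y < N → v y ≡ ℓ → v (suc x) ≡ suc x →
            Spells v (suc x) (suc (suc x)) g (suc r) → NoneFrom (suc x) (suc r) → suc r < N × v (suc r) ≡ ℓ
  resumed {ℓ} {x} {y} {r = r} vx x<y y<N vy vsx s none = sr<N , vsr
    where
    ℓ≤x : ℓ ≤ x
    ℓ≤x = subst (_≤ x) vx (v≤ x)
    r<y : r < y
    r<y = ≰⇒> λ y≤r → inside≢ℓ (s≤s ℓ≤x) vsx s x<y (s≤s y≤r) vy
    sr<N : suc r < N
    sr<N = ≤-<-trans r<y y<N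
    vr : v r ≡ suc x
    vr = spells-last vsx s
    stale : v (suc r) ≢ suc r
    stale = closing sr<N (λ {z} r<z z<N e → none r<z z<N (trans e vr)) (λ e → contradiction (trans (sym vr) e) λ ())
    vsr : v (suc r) ≡ ℓ
    vsr with m≤n⇒m<n∨m≡n (s≤s⁻¹ (older vsx s none sr<N stale)) | m≤n⇒m<n∨m≡n r<y
    ... | inj₂ e   | _         = trans (sym (idem (suc r))) (trans (cong v e) vx)
    ... | inj₁ _   | inj₂ refl = vy
    ... | inj₁ u<x | inj₁ sr<y =
      trans (sym (idem (suc r))) (trans (noncrossing u<x (<⇒≤ (spells-≤ s)) sr<y y<N (idem (suc r)) (trans vx (sym vy))) vx)

  -- The bound `b` on the points left carries the recursion. The result includes `NoneFrom`, since
  -- `closing` and `older` apply only to a block read to its end.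
  read : ∀ b {ℓ x} → N ≤ x + b → x < N → v x ≡ ℓ →
         ∃₂ λ f r → Spells v ℓ (suc x) f (suc r) × r < N × NoneFrom ℓ (suc r)
  read zero    {x = x} N≤ x<N _ =
      contradiction (≤-trans x<N (≤-trans N≤ (≤-reflexive (+-identityʳ x)))) (<-irrefl refl)
  read (suc b) {ℓ} {x} N≤ x<N vx with anyUpTo? (λ y → (x <? y) ×-dec (v y ≟ ℓ)) N
  ... | no none = nil , x , nil , x<N , λ x<y y<N vy → none (_ , y<N , x<y , vy)
  ... | yes (y , y<N , x<y , vy) with fresh-after-nonlast x<y y<N (trans vy (sym vx))
  ...   | vsx with read b (≤-trans N≤ (≤-reflexive (+-suc x b))) (≤-<-trans x<y y<N) vsx
  ...     | g , r , s , r<N , none with resumed vx x<y y<N vy vsx s none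
  ...       | sr<N , vsr
    with read b (≤-trans N≤ (≤-trans (≤-reflexive (+-suc x b)) (+-monoˡ-≤ b (<⇒≤ (spells-≤ s))))) sr<N vsr
  ...         | f , r′ , s′ , r′<N , none′ = cons g f , r′ , cons vsx s vsr s′ , r′<N , none′

  spelling-exists : 0 < N → odd N ≡ false → ∃₂ λ g h → Spelling v N g h
  spelling-exists 0<N even with n≤0⇒n≡0 (v≤ 0)
  ... | v0 with read N ≤-refl 0<N v0
  ...   | g , r , s , r<N , none with suc r <? N
  -- The first tree stops at an odd position, so it cannot exhaust the even number `N` of points.
  ...     | no r≮N = contradiction (trans (sym even) (trans (cong odd (≤-antisym (≮⇒≥ r≮N) r<N)) (odd-end s))) λ ()
  ...     | yes sr<N with decidable-stable (v (suc r) ≟ suc r) (λ stale → contradiction (older v0 s none sr<N stale) λ ())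
  ...       | middle with read N (m≤n+m N (suc r)) sr<N middle
  ...         | h , r′ , s′ , r′<N , none′ =
      g , h , spelling v0 s middle (subst (Spells v (suc r) (suc (suc r)) h) end s′)
    where
    vr : v r ≡ 0
    vr = spells-last v0 s
    vr′ : v r′ ≡ suc r
    vr′ = spells-last middle s′
    end : suc r′ ≡ N
    end with m≤n⇒m<n∨m≡n r′<N
    ... | inj₂ e     = e
    -- A remaining point would continue a block older than the second tree and different from that
    -- of 1; starting strictly between 0 and `r`, it would cross the block of 1.
    ... | inj₁ sr′<N =
        contradiction (noncrossing 0<u u<r (<⇒≤ (spells-≤ s′)) sr′<N (trans v0 (sym vr)) (idem (suc r′)))
                         (λ e → u≢0 (trans (sym (idem (suc r′))) (trans (sym e) v0)))
      where
      stale : v (suc r′) ≢ suc r′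
      stale = closing sr′<N (λ r<z z<N e → none′ r<z z<N (trans e vr′)) (λ e → contradiction (trans (sym vr′) e) λ ())
      u<sr : v (suc r′) < suc r
      u<sr = older middle s′ none′ sr′<N stale
      u≢0 : v (suc r′) ≢ 0
      u≢0 = none (≤-trans (n≤1+n _) (spells-≤ s′)) sr′<N
      0<u : 0 < v (suc r′)
      0<u = ≤∧≢⇒< z≤n (u≢0 ∘ sym)
      u<r : v (suc r′) < r
      u<r = ≤∧≢⇒< (s≤s⁻¹ u<sr) (λ e → u≢0 (trans (sym (idem (suc r′))) (trans (cong v e) vr)))

-- Block labels of a partition and its Kreweras dual

even<odd⇒≤ : ∀ {a b} → 2 * a < suc (2 * b) → a ≤ b
even<odd⇒≤ a<b = 2*-cancel-≤ (s≤s⁻¹ a<b)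

odd<even⇒< : ∀ {a b} → suc (2 * a) < 2 * b → a < b
odd<even⇒< a<b = 2*-cancel-< (<⇒≤ a<b)

record Canonical (R : ℕ → ℕ → Set) (v : ℕ → ℕ) : Set where
  field
    canonical-≤   : ∀ x → v x ≤ x
    canonical-rel : ∀ x → R (v x) x
    R⇒≡       : ∀ {x y} → R x y → v x ≡ v y

abstract
  canonical : ∀ {R : ℕ → ℕ → Set} → (∀ x y → Dec (R x y)) → (∀ {x} → R x x) → (∀ {x y} → R x y → R y x) →
              (∀ {x y z} → R x y → R y z → R x z) → ∃ (Canonical R)
  canonical {R} R? rfl sm tr = v , record
    { canonical-≤   = λ x → proj₁ (proj₂ (proj₂ (minimum x)))
    ; canonical-rel = related
    ; R⇒≡       = λ r → ≤-antisym (minimal (tr (related _) (sm r))) (minimal (tr (related _) r))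
    }
    where
    minimum : ∀ x → ∃ λ m → R m x × m ≤ x × (∀ {k} → R k x → m ≤ k)
    minimum x = least (λ y → R? y x) x x ≤-refl rfl
    v : ℕ → ℕ
    v x = proj₁ (minimum x)
    related : ∀ x → R (v x) x
    related x = proj₁ (proj₂ (minimum x))
    minimal : ∀ {x k} → R k x → v x ≤ k
    minimal {x} = proj₂ (proj₂ (proj₂ (minimum x)))

put-≡ : ∀ {u w a b} → u < w → a < b → put w u (λ x → x) a ≡ put w u (λ x → x) b → a ≡ u × b ≡ w
put-≡ {u} {w} {a} {b} u<w a<b e with a ≟ w | b ≟ w
... | yes refl | yes refl = contradiction a<b (<-irrefl refl)
... | yes refl | no b≢w   =
    contradiction (<-trans u<w a<b) (<-irrefl (trans (sym (put-at a u (λ x → x))) (trans e (put-other w u (λ x → x) b≢w))))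
... | no a≢w   | yes refl = trans (sym (put-other w u (λ x → x) a≢w)) (trans e (put-at w u (λ x → x))) , refl
... | no a≢w   | no b≢w   =
    contradiction a<b (<-irrefl (trans (sym (put-other w u (λ x → x) a≢w)) (trans e (put-other w u (λ x → x) b≢w))))

module _ {n : ℕ} {π σ : Rel n} where

  combined? : ∀ x y → Dec (Combined π σ x y)
  combined? x y = map′
    [ (λ (i , j , e , e′ , r) → subst₂ (Combined π σ) (sym e) (sym e′) (unprimed i j r))
    , (λ (i , j , e , e′ , r) → subst₂ (Combined π σ) (sym e) (sym e′) (primed i j r)) ]′
    (λ { (unprimed i j r) → inj₁ (i , j , refl , refl , r) ; (primed i j r) → inj₂ (i , j , refl , refl , r) })
    (any? (λ i → any? λ j → (x ≟ 2 * toℕ i) ×-dec ((y ≟ 2 * toℕ j) ×-dec (lookup (lookup π i) j ≟ᵇ true)))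
     ⊎-dec any? (λ i → any? λ j → (x ≟ suc (2 * toℕ i)) ×-dec ((y ≟ suc (2 * toℕ j)) ×-dec (lookup (lookup σ i) j ≟ᵇ true))))

  combined-unprimed : ∀ {x y i j} → Combined π σ x y → x ≡ 2 * toℕ i → y ≡ 2 * toℕ j → i ∼[ π ] j
  combined-unprimed {i = i} {j} (unprimed i′ j′ r) e e′ =
    subst₂ (λ i j → i ∼[ π ] j) (toℕ-injective (2*-cancel e)) (toℕ-injective (2*-cancel e′)) r
  combined-unprimed {i = i} (primed i′ j′ r) e e′ = contradiction (sym e) (even≢odd (toℕ i) (toℕ i′))

  combined-primed : ∀ {x y i j} → Combined π σ x y → x ≡ suc (2 * toℕ i) → y ≡ suc (2 * toℕ j) → i ∼[ σ ] j
  combined-primed {i = i} {j} (primed i′ j′ r) e e′ =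
    subst₂ (λ i j → i ∼[ σ ] j) (toℕ-injective (2*-cancel (suc-injective e)))
      (toℕ-injective (2*-cancel (suc-injective e′))) r
  combined-primed {i = i} (unprimed i′ j′ r) e e′ = contradiction e (even≢odd (toℕ i′) (toℕ i))

  combined-sym : IsPartition π → IsPartition σ → ∀ {x y} → Combined π σ x y → Combined π σ y x
  combined-sym pπ pσ (unprimed i j r) = unprimed j i (IsPartition.sym pπ i j r)
  combined-sym pπ pσ (primed i j r)   = primed j i (IsPartition.sym pσ i j r)

  combined-trans : IsPartition π → IsPartition σ → ∀ {x y y′ z} → Combined π σ x y → Combined π σ y′ z → y ≡ y′ →
                   Combined π σ x z
  combined-trans pπ pσ (unprimed i j r) s@(unprimed j′ l _) e =
      unprimed i l (IsPartition.trans pπ i j l r (combined-unprimed s (sym e) refl))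
  combined-trans pπ pσ (primed i j r)   s@(primed j′ l _)   e =
      primed i l (IsPartition.trans pσ i j l r (combined-primed s (sym e) refl))
  combined-trans pπ pσ (unprimed i j r) (primed j′ l _)     e = contradiction e (even≢odd (toℕ j) (toℕ j′))
  combined-trans pπ pσ (primed i j r)   (unprimed j′ l _)   e = contradiction (sym e) (even≢odd (toℕ j′) (toℕ j))

module _ {n : ℕ} {π σ : Rel n} (ncπ : IsNoncrossingPartition π) (K : IsKrewerasDual π σ) where
  private
    N  = 2 * n
    pπ = proj₁ ncπ
    pσ = IsKrewerasDual.partition K

    -- Adding equality makes the relation reflexive at positions from `2 * n` on, so least
    -- representatives exist on all of ℕ.
    _≈_ : ℕ → ℕ → Set
    x ≈ y = Combined π σ x y ⊎ x ≡ y

    ≈-sym : ∀ {x y} → x ≈ y → y ≈ x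
    ≈-sym (inj₁ r)    = inj₁ (combined-sym pπ pσ r)
    ≈-sym (inj₂ refl) = inj₂ refl

    ≈-trans : ∀ {x y z} → x ≈ y → y ≈ z → x ≈ z
    ≈-trans (inj₁ r)    (inj₁ s)    = inj₁ (combined-trans pπ pσ r s refl)
    ≈-trans (inj₁ r)    (inj₂ refl) = inj₁ r
    ≈-trans (inj₂ refl) s           = s

    labelling : ∃ (Canonical _≈_)
    labelling = canonical (λ x y → combined? x y ⊎-dec (x ≟ y)) (inj₂ refl) ≈-sym ≈-trans

  blockLabel : ℕ → ℕ
  blockLabel = proj₁ labelling

  private
    v = blockLabel
    open Canonical (proj₂ labelling)

    ≡⇒≈ : ∀ {x y} → v x ≡ v y → x ≈ y
    ≡⇒≈ {x} {y} e = ≈-trans (≈-sym (canonical-rel x)) (subst (_≈ y) (sym e) (canonical-rel y))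

    ≡⇒combined< : ∀ {x y} → x < y → v x ≡ v y → Combined π σ x y
    ≡⇒combined< x<y e with ≡⇒≈ e
    ... | inj₁ r    = r
    ... | inj₂ refl = contradiction x<y (<-irrefl refl)

  blockLabel-labelled : Labelled blockLabel π σ
  blockLabel-labelled = record
    { unprimed⇔ = λ i j → mk⇔ (λ r → R⇒≡ (inj₁ (unprimed i j r))) (λ e → even i j (≡⇒≈ e))
    ; primed⇔   = λ i j → mk⇔ (λ r → R⇒≡ (inj₁ (primed i j r))) (λ e → odds i j (≡⇒≈ e))
    }
    where
    even : ∀ i j → (2 * toℕ i) ≈ (2 * toℕ j) → i ∼[ π ] j
    even i j (inj₁ r) = combined-unprimed r refl refl
    even i j (inj₂ e) = subst (i ∼[ π ]_) (toℕ-injective (2*-cancel e)) (IsPartition.refl pπ i)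
    odds : ∀ i j → suc (2 * toℕ i) ≈ suc (2 * toℕ j) → i ∼[ σ ] j
    odds i j (inj₁ r) = combined-primed r refl refl
    odds i j (inj₂ e) = subst (i ∼[ σ ]_) (toℕ-injective (2*-cancel (suc-injective e))) (IsPartition.refl pσ i)

  private
    open Labelled blockLabel-labelled

    parity-≈ : ∀ {x y} → x ≈ y → odd x ≡ odd y
    parity-≈ (inj₁ r)    = combined-odd r
    parity-≈ (inj₂ refl) = refl

    idem : ∀ x → v (v x) ≡ v x
    idem x = R⇒≡ (canonical-rel x)

    nc : ∀ {x y z w} → x < y → y < z → z < w → w < N → v x ≡ v z → v y ≡ v w → v x ≡ v y
    nc {x} {y} x<y y<z z<w w<N e e′ = decidable-stable (v x ≟ v y) λ ¬e →
      IsKrewerasDual.noncrossing K _ _ _ _ x<y y<z z<w w<N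
        (≡⇒combined< (<-trans x<y y<z) e , ≡⇒combined< (<-trans y<z z<w) e′ , λ r → ¬e (R⇒≡ (inj₁ r)))

    -- Since σ is coarsest, it is enough that the partition τ joining only i and j crosses no block of π.
    union-of-blocks⇒primed : ∀ (i j : Fin n) → toℕ i < toℕ j →
      (∀ (s t : Fin n) → s ∼[ π ] t → toℕ i < toℕ s → toℕ s ≤ toℕ j → toℕ i < toℕ t × toℕ t ≤ toℕ j) → i ∼[ σ ] j
    union-of-blocks⇒primed i j i<j closed =
      IsKrewerasDual.coarsest K τ (kernel-partition c τ⇔) τ-noncrossing i j
        (from (τ⇔ i j) (trans (put-other (toℕ j) (toℕ i) (λ x → x) (<⇒≢ i<j)) (sym (put-at (toℕ j) (toℕ i) (λ x → x)))))
      where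
      c : ℕ → ℕ
      c = put (toℕ j) (toℕ i) (λ x → x)
      τ : Rel n
      τ = kernel c
      τ⇔ : ∀ s t → (s ∼[ τ ] t) ⇔ (c (toℕ s) ≡ c (toℕ t))
      τ⇔ = kernel-⇔ c
      pair : ∀ s t → suc (2 * toℕ s) < suc (2 * toℕ t) → s ∼[ τ ] t → s ≡ i × t ≡ j
      pair s t s<t r with put-≡ i<j (2*-cancel-< (s≤s⁻¹ s<t)) (to (τ⇔ s t) r)
      ... | a , b = toℕ-injective a , toℕ-injective b
      τ-noncrossing : Noncrossing (Combined π τ) N
      τ-noncrossing _ _ _ _ a<b b<c c<e e<N (unprimed s t r , unprimed s′ t′ r′ , ¬s) =
        ¬s (unprimed s s′ (from (unprimed⇔ s s′) (nc a<b b<c c<e e<N (to (unprimed⇔ s t) r) (to (unprimed⇔ s′ t′) r′))))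
      τ-noncrossing _ _ _ _ a<b b<c c<e e<N (unprimed s t r , primed s′ t′ r′ , _) with pair s′ t′ (<-trans b<c c<e) r′
      ... | refl , refl =
          <⇒≱ (proj₁ (closed t s (IsPartition.sym pπ s t r) (odd<even⇒< b<c) (even<odd⇒≤ c<e))) (even<odd⇒≤ a<b)
      τ-noncrossing _ _ _ _ a<b b<c c<e e<N (primed s t r , unprimed s′ t′ r′ , _) with pair s t (<-trans a<b b<c) r
      ... | refl , refl = <⇒≱ (odd<even⇒< c<e) (proj₂ (closed s′ t′ r′ (odd<even⇒< a<b) (even<odd⇒≤ b<c)))
      τ-noncrossing _ _ _ _ a<b b<c c<e e<N (primed s t r , primed s′ t′ r′ , ¬s) with pair s t (<-trans a<b b<c) r
          | pair s′ t′ (<-trans b<c c<e) r′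
      ... | refl , _ | refl , _ = <-irrefl refl a<b

    -- Here `a` and `b` are the ends of one block; another block with points inside and outside the
    -- interval between them would cross it.
    block-hull : ∀ (a b : Fin n) → v (2 * toℕ a) ≡ v (2 * toℕ b) →
      (∀ t → v (2 * toℕ t) ≡ v (2 * toℕ a) → toℕ a ≤ toℕ t × toℕ t ≤ toℕ b) →
      ∀ s t → s ∼[ π ] t → toℕ a ≤ toℕ s → toℕ s ≤ toℕ b → toℕ a ≤ toℕ t × toℕ t ≤ toℕ b
    block-hull a b a≡b ends s t r a≤s s≤b with v (2 * toℕ s) ≟ v (2 * toℕ a)
    ... | yes e = ends t (trans (sym (to (unprimed⇔ s t) r)) e)
    ... | no ¬e = ≮⇒≥ below , ≮⇒≥ above
      where
      e = to (unprimed⇔ s t) r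
      a<s : 2 * toℕ a < 2 * toℕ s
      a<s = ≤∧≢⇒< (2*-mono-≤ a≤s) λ x → ¬e (cong v (sym x))
      s<b : 2 * toℕ s < 2 * toℕ b
      s<b = ≤∧≢⇒< (2*-mono-≤ s≤b) λ x → ¬e (trans (cong v x) (sym a≡b))
      below : ¬ toℕ t < toℕ a
      below t<a = ¬e (trans e (nc (2*-mono-< t<a) a<s s<b (2*-mono-< (toℕ<n b)) (sym e) a≡b))
      above : ¬ toℕ b < toℕ t
      above b<t = ¬e (sym (nc a<s s<b (2*-mono-< b<t) (2*-mono-< (toℕ<n t)) a≡b e))

    closing : ∀ {x} → suc x < N → (∀ {y} → x < y → y < N → v y ≢ v x) → v x ≢ 0 → v (suc x) ≢ suc x
    closing {x} sx<N last vx≢0 fresh = by-parity (point {n} (<-trans (n<1+n x) sx<N)) sx<N last vx≢0 fresh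
      where
      by-parity : ∀ {x} → Point {n} x → suc x < N → (∀ {y} → x < y → y < N → v y ≢ v x) → v x ≢ 0 → v (suc x) ≢ suc x
      -- If the block after the primed `i` starts at `a` and ends at `b`, the points from `a` to `b`
      -- form a union of blocks of π. The dual therefore joins `i` to the later `b`, and `i` is not
      -- last.
      by-parity (primed i) sx<N last _ fresh =
          last {suc (2 * toℕ b)} (s≤s (2*-mono-< i<b)) (odd<even (toℕ<n b)) (sym (to (primed⇔ i b) i∼b))
        where
        a<n : suc (toℕ i) < n
        a<n = 2*-cancel-< (subst (_< N) (sym (2*suc (toℕ i))) sx<N)
        va : v (2 * suc (toℕ i)) ≡ 2 * suc (toℕ i)
        va = trans (cong v (2*suc (toℕ i))) (trans fresh (sym (2*suc (toℕ i))))
        top = greatest (λ t → v (2 * t) ≟ v (2 * suc (toℕ i))) n a<n refl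
        a b : Fin n
        a = fromℕ< a<n
        b = fromℕ< (proj₁ (proj₂ (proj₂ top)))
        a≡ : toℕ a ≡ suc (toℕ i)
        a≡ = toℕ-fromℕ< a<n
        b≡ : toℕ b ≡ proj₁ top
        b≡ = toℕ-fromℕ< (proj₁ (proj₂ (proj₂ top)))
        vab : v (2 * toℕ a) ≡ v (2 * toℕ b)
        vab =
            trans (cong (λ z → v (2 * z)) a≡)
              (trans (sym (proj₁ (proj₂ (proj₂ (proj₂ top))))) (cong (λ z → v (2 * z)) (sym b≡)))
        ends : ∀ t → v (2 * toℕ t) ≡ v (2 * toℕ a) → toℕ a ≤ toℕ t × toℕ t ≤ toℕ b
        ends t e =
            subst (_≤ toℕ t) (sym a≡) (2*-cancel-≤ (subst (_≤ 2 * toℕ t) (trans e′ va) (canonical-≤ (2 * toℕ t)))) ,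
                   subst (toℕ t ≤_) (sym b≡) (proj₂ (proj₂ (proj₂ (proj₂ top))) (toℕ<n t) e′)
          where e′ = trans e (cong (λ z → v (2 * z)) a≡)
        i<b : toℕ i < toℕ b
        i<b = subst (toℕ i <_) (sym b≡) (proj₁ (proj₂ top))
        i∼b : i ∼[ σ ] b
        i∼b = union-of-blocks⇒primed i b i<b λ s t r i<s s≤b →
          subst (λ z → z ≤ toℕ t × toℕ t ≤ toℕ b) a≡ (block-hull a b vab ends s t r (subst (_≤ toℕ s) (sym a≡) i<s) s≤b)
      -- The points from the first point `a` of the block to its last point `i` form a union of
      -- blocks of π. A nonzero label provides a point `U` before `a`; the dual joins `U` to `i`, so
      -- the primed `i` is not the first of its block.
      by-parity (unprimed i) sx<N last vx≢0 fresh =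
          go (point {n} (≤-<-trans (canonical-≤ (2 * toℕ i)) (2*-mono-< (toℕ<n i)))) refl
        where
        go : ∀ {y} → Point {n} y → y ≡ v (2 * toℕ i) → ⊥
        go (primed a) e =
            contradiction (trans (trans (cong not (sym (odd-2* (toℕ a)))) (cong odd e))
              (trans (parity-≈ (canonical-rel (2 * toℕ i))) (odd-2* (toℕ i)))) λ ()
        go (unprimed a) e = from-first (toℕ a) refl
          where
          vai : v (2 * toℕ a) ≡ v (2 * toℕ i)
          vai = trans (cong v e) (idem (2 * toℕ i))
          ends : ∀ t → v (2 * toℕ t) ≡ v (2 * toℕ a) → toℕ a ≤ toℕ t × toℕ t ≤ toℕ i
          ends t e′ = 2*-cancel-≤ (subst (_≤ 2 * toℕ t) (trans e′ (trans vai (sym e))) (canonical-≤ (2 * toℕ t))) ,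
                      ≮⇒≥ λ i<t → last (2*-mono-< i<t) (2*-mono-< (toℕ<n t)) (trans e′ vai)
          a≤i : toℕ a ≤ toℕ i
          a≤i = proj₁ (ends i (sym vai))
          from-first : ∀ m → m ≡ toℕ a → ⊥
          from-first zero    m≡ = vx≢0 (trans (sym e) (cong (2 *_) (sym m≡)))
          from-first (suc u) m≡ = <⇒≱ (s≤s (2*-mono-< U<i))
            (subst (_≤ suc (2 * toℕ U)) (trans (to (primed⇔ U i) U∼i) fresh) (canonical-≤ (suc (2 * toℕ U))))
            where
            u<n : u < n
            u<n = <-trans (n<1+n u) (subst (_< n) (sym m≡) (toℕ<n a))
            U : Fin n
            U = fromℕ< u<n
            U≡ : suc (toℕ U) ≡ toℕ a
            U≡ = trans (cong suc (toℕ-fromℕ< u<n)) m≡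
            U<i : toℕ U < toℕ i
            U<i = subst (_≤ toℕ i) (sym U≡) a≤i
            U∼i : U ∼[ σ ] i
            U∼i = union-of-blocks⇒primed U i U<i λ s t r U<s s≤i →
              subst (λ z → z ≤ toℕ t × toℕ t ≤ toℕ i) (sym U≡) (block-hull a i vai ends s t r (subst (_≤ toℕ s) U≡ U<s) s≤i)

  blockLabels : BlockLabels N blockLabel
  blockLabels = record
    { v≤          = canonical-≤
    ; idem        = idem
    ; same-parity = λ {x} {y} e → parity-≈ (≡⇒≈ {x} {y} e)
    ; noncrossing = nc
    ; closing     = closing
    }

-- The bijection

bool-ext : ∀ {a b : Bool} → (a ≡ true → b ≡ true) → (b ≡ true → a ≡ true) → a ≡ b
bool-ext {false} {false} f g = refl
bool-ext {false} {true}  f g = g refl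
bool-ext {true}  {b}     f g = sym (f refl)

vec-ext : ∀ {A : Set} {n} {xs ys : Vec A n} → (∀ i → lookup xs i ≡ lookup ys i) → xs ≡ ys
vec-ext {xs = xs} {ys} e = trans (sym (tabulate∘lookup xs)) (trans (tabulate-cong e) (tabulate∘lookup ys))

rel-ext : ∀ {n} {R S : Rel n} → (∀ i j → i ∼[ R ] j → i ∼[ S ] j) → (∀ i j → i ∼[ S ] j → i ∼[ R ] j) → R ≡ S
rel-ext f g = vec-ext λ i → vec-ext λ j → bool-ext (f i j) (g i j)

krewerasDual-unique : ∀ {n} {π σ τ : Rel n} → IsKrewerasDual π σ → IsKrewerasDual π τ → σ ≡ τ
krewerasDual-unique K K′ = rel-ext
  (IsKrewerasDual.coarsest K′ _ (IsKrewerasDual.partition K) (IsKrewerasDual.noncrossing K))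
  (IsKrewerasDual.coarsest K _ (IsKrewerasDual.partition K′) (IsKrewerasDual.noncrossing K′))

labelled-functional : ∀ {n v} {π π′ σ σ′ : Rel n} → Labelled v π σ → Labelled v π′ σ′ → π ≡ π′
labelled-functional L L′ = rel-ext
  (λ i j r → from (Labelled.unprimed⇔ L′ i j) (to (Labelled.unprimed⇔ L i j) r))
  (λ i j r → from (Labelled.unprimed⇔ L i j) (to (Labelled.unprimed⇔ L′ i j) r))

-- A label is the least point of its class, so the labelling is determined by its kernel.
labels-≗ : ∀ {N v w g h g′ h′} → Spelling v N g h → Spelling w N g′ h′ →
           (∀ {x y} → x < N → y < N → v x ≡ v y → w x ≡ w y) →
           (∀ {x y} → x < N → y < N → w x ≡ w y → v x ≡ v y) →
           ∀ {x} → x < N → v x ≡ w x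
labels-≗ {N} S T v⇒w w⇒v x<N = ≤-antisym (below T S w⇒v x<N) (below S T v⇒w x<N)
  where
  below : ∀ {v w g h g′ h′} → Spelling v N g h → Spelling w N g′ h′ →
          (∀ {x y} → x < N → y < N → v x ≡ v y → w x ≡ w y) → ∀ {x} → x < N → w x ≤ v x
  below {v} {w} S T v⇒w {x} x<N with label-≤ S x<N
  ... | vx≤x , idem = subst (_≤ v x) (v⇒w vx<N x<N idem) (proj₁ (label-≤ T vx<N))
    where vx<N = ≤-<-trans vx≤x x<N

spelling-cong : ∀ {v w N g h} → (∀ {x} → x < N → v x ≡ w x) → Spelling v N g h → Spelling w N g h
spelling-cong v≗w S = spelling (trans (sym (v≗w (≤-<-trans z≤n (split<N S)))) start)
  (spells-cong (λ _ x<s → v≗w (<-trans x<s (split<N S))) first)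
  (trans (sym (v≗w (split<N S))) middle)
  (spells-cong (λ _ x<N → v≗w x<N) second)
  where open Spelling S

-- Both σ and σ′ are the dual of π, hence equal. The two labellings then have the same kernel, so
-- they agree below `2 * n` and spell the same trees.
spelling-injective : ∀ {n v w g h g′ h′} {π σ σ′ : Rel n} → Labelled v π σ → Labelled w π σ′ →
                     Spelling v (2 * n) g h → Spelling w (2 * n) g′ h′ → g ≡ g′ × h ≡ h′
spelling-injective {n} {π = π} {σ} L L′ S T with krewerasDual-unique (spelling⇒krewerasDual L S) (spelling⇒krewerasDual L′ T)
... | refl = spelling-unique (spelling-cong (labels-≗ S T (transfer L L′ S) (transfer L′ L T)) S) T
  where
  transfer : ∀ {v w g h} → Labelled v π σ → Labelled w π σ → Spelling v (2 * n) g h →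
             ∀ {x y} → x < 2 * n → y < 2 * n → v x ≡ v y → w x ≡ w y
  transfer L L′ S x<N y<N e = combined⇒≡ L′ (≡⇒combined L x<N y<N
    (trans (sym (label-odd S x<N)) (trans (cong odd e) (label-odd S y<N))) e)

spells-functional : ∀ {v w ℓ p f r r′} → Spells v ℓ p f r → Spells w ℓ p f r′ → ∀ {x} → p ≤ x → x < r → v x ≡ w x
spells-functional nil nil p≤x x<r = contradiction x<r (≤⇒≯ p≤x)
spells-functional (cons {q = q} e s e′ t) (cons a s′ a′ t′) p≤x x<r with trans (spells-end s) (sym (spells-end s′))
    | region {q = q} p≤x x<r
... | _    | at-p refl  = trans e (sym a)
... | _    | inside b c = spells-functional s s′ b c
... | refl | at-q refl  = trans e′ (sym a′)
... | refl | after b c  = spells-functional t t′ b c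

spelling-functional : ∀ {v w N g h} → Spelling v N g h → Spelling w N g h → ∀ {x} → x < N → v x ≡ w x
spelling-functional S T {x} x<N with trans (spells-end (Spelling.first S)) (sym (spells-end (Spelling.first T)))
    | <-cmp x (Spelling.split S)
spelling-functional S T {zero}  x<N | _    | _          = trans (Spelling.start S) (sym (Spelling.start T))
spelling-functional S T {suc x} x<N | _    | tri< a _ _ =
    spells-functional (Spelling.first S) (Spelling.first T) (s≤s z≤n) a
spelling-functional S T {suc x} x<N | refl | tri≈ _ refl _ = trans (Spelling.middle S) (sym (Spelling.middle T))
spelling-functional S T {suc x} x<N | refl | tri> _ _ a =
    spells-functional (Spelling.second S) (Spelling.second T) a x<N

labelled-cong : ∀ {n v w} {π σ : Rel n} → (∀ {x} → x < 2 * n → v x ≡ w x) → Labelled v π σ → Labelled w π σ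
labelled-cong {n} {v} {w} v≗w L = record
  { unprimed⇔ = λ i j → subst₂ (λ a b → _ ⇔ (a ≡ b))
      (v≗w (2*-mono-< (toℕ<n i))) (v≗w (2*-mono-< (toℕ<n j)))
      (Labelled.unprimed⇔ L i j)
  ; primed⇔   = λ i j → subst₂ (λ a b → _ ⇔ (a ≡ b))
      (v≗w (odd<even (toℕ<n i))) (v≗w (odd<even (toℕ<n j)))
      (Labelled.primed⇔ L i j)
  }

size-pair : ∀ g h → size (cons g (cons h nil)) ≡ 2 + (size g + size h)
size-pair g h = cong suc (trans (+-suc (size g) (size h + 0)) (cong (λ x → suc (size g + x)) (+-identityʳ (size h))))

spelling-size : ∀ {v m g h} → Spelling v (2 * suc m) g h → m ≡ size g + size h
spelling-size {g = g} {h} S = suc-injective (2*-cancel (trans (spells-end second)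
  (trans (cong (λ s → suc s + 2 * size h) (spells-end first)) (rearrange (size g) (size h)))))
  where
  open Spelling S
  rearrange : ∀ a b → suc (1 + 2 * a) + 2 * b ≡ 2 * suc (a + b)
  rearrange = solve-∀

partition : ∀ n → Forest → Rel n
partition n (cons g (cons h nil)) = kernel (λ i → labels g h (2 * i))
-- A default value, never met under `IsForest d 2 k`, which forces two trees.
partition n _                     = kernel (λ i → i)

module _ (d k : ℕ) where
  private
    n : ℕ
    n = suc (d * k)

  module _ (g h : Forest) (size≡ : size (cons g (cons h nil)) ≡ 2 + d * k) where
    pair-spelling : Spelling (labels g h) (2 * n) g h
    pair-spelling = subst (λ m → Spelling (labels g h) (2 * suc m) g h)
      (suc-injective (suc-injective (trans (sym (size-pair g h)) size≡))) (labels-spelling g h)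

  labelled-partition : ∀ g h →
                       Labelled {n} (labels g h) (partition n (cons g (cons h nil)))
                         (kernel (λ i → labels g h (suc (2 * i))))
  labelled-partition g h = kernel-labelled (labels g h)

  partition-good : ∀ f → IsForest d 2 k f → Good d (partition n f)
  partition-good (cons g (cons h nil)) (a , _ , s) =
    spelling⇒noncrossing L S , proj₁ sizes , _ , spelling⇒krewerasDual L S , proj₂ sizes
    where
    S = pair-spelling g h s
    L = labelled-partition g h
    sizes = counts⇒sizes L S (arities⇒labels S a)

  partition-injective : ∀ f f′ → IsForest d 2 k f → IsForest d 2 k f′ → partition n f ≡ partition n f′ → f ≡ f′
  partition-injective (cons g (cons h nil)) (cons g′ (cons h′ nil)) (_ , _ , s) (_ , _ , s′) e
    with spelling-injective (labelled-partition g h)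
           (subst (λ π → Labelled (labels g′ h′) π (kernel (λ i → labels g′ h′ (suc (2 * i))))) (sym e)
             (labelled-partition g′ h′))
           (pair-spelling g h s) (pair-spelling g′ h′ s′)
  ... | refl , refl = refl

  labelled⇒partition : ∀ {π σ : Rel n} {v g h} → Labelled v π σ → Spelling v (2 * n) g h →
                       BlocksOfSize1or d π → BlocksOfSize1or d σ → ∃ λ f → IsForest d 2 k f × π ≡ partition n f
  labelled⇒partition {π} {g = g} {h} L S bπ bσ =
    cons g (cons h nil) , (labels⇒arities S (sizes⇒counts L S bπ bσ) , refl , size≡) ,
    labelled-functional (labelled-cong (spelling-functional S (pair-spelling g h size≡)) L) (labelled-partition g h)
    where
    size≡ : size (cons g (cons h nil)) ≡ 2 + d * k
    size≡ = trans (size-pair g h) (cong (2 +_) (sym (spelling-size S)))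

  partition-surjective : ∀ {π} → Good d π → ∃ λ f → IsForest d 2 k f × π ≡ partition n f
  partition-surjective (nc , bπ , σ , K , bσ) =
    let g , h , S = spelling-exists (blockLabels nc K) (s≤s z≤n) (odd-2* n) in
    labelled⇒partition (blockLabel-labelled nc K) S bπ bσ

-- Injectivity is asked only on the list because `partition n` is shown injective only on forests
-- with the right width and size.
map-unique : ∀ {A B : Set} (F : A → B) {xs : List A} → (∀ {x y} → x ∈ xs → y ∈ xs → F x ≡ F y → x ≡ y) →
             Unique xs → Unique (map F xs)
map-unique F inj []       = []
map-unique F inj (p ∷ ps) =
  All.map⁺ (All.tabulate λ y∈ e → All.lookup p y∈ (inj (here refl) (there y∈) e)) ∷
  map-unique F (λ a b → inj (there a) (there b)) ps

blockSize-zero : ∀ {d k g h} → IsForest d 2 k (cons g (cons h nil)) →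
              blockSize (partition (suc (d * k)) (cons g (cons h nil))) zero ≡ suc (width g)
blockSize-zero {d} {k} {g} {h} (_ , _ , s) =
  trans (blockSize-unprimed (labelled-partition d k g h) S zero)
    (trans (cong (λ z → count (labels g h) z (2 * suc (d * k))) (Spelling.start S)) (count-first S))
  where S = pair-spelling d k g h s

-- The two cardinalities

module _ (d k : ℕ) .{{_ : NonZero d}} where
  private
    n : ℕ
    n = suc (d * k)

  good-cardinality : HasCardinality {n} (Good d) (length (forests d 2 k))
  good-cardinality =
    map (partition n) (forests d 2 k) , map-unique (partition n) injective (forests-unique d 2 k) ,
    (λ π → mk⇔ sound complete) , length-map (partition n) (forests d 2 k)
    where
    injective : ∀ {f f′} → f ∈ forests d 2 k → f′ ∈ forests d 2 k → partition n f ≡ partition n f′ → f ≡ f′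
    injective {f} {f′} p q = partition-injective d k f f′ (forests-sound d 2 k p) (forests-sound d 2 k q)
    sound : ∀ {π} → π ∈ map (partition n) (forests d 2 k) → Good d π
    sound = map-elim (Good d) (partition n) λ {f} q → partition-good d k f (forests-sound d 2 k q)
    complete : ∀ {π} → Good d π → π ∈ map (partition n) (forests d 2 k)
    complete G = let f , F , e = partition-surjective d k G in
      subst (_∈ map (partition n) (forests d 2 k)) (sym e) (∈-map⁺ (partition n) (forests-complete d 2 k F))

  singleton-partition : Forest → Rel n
  singleton-partition f = partition n (cons nil f)

  good-singleton-cardinality : HasCardinality {n} (λ π → Good d π × blockSize π zero ≡ 1) (length (forests d 1 k))
  good-singleton-cardinality =
    map singleton-partition (forests d 1 k) , map-unique singleton-partition injective (forests-unique d 1 k) ,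
    (λ π → mk⇔ sound complete) , length-map singleton-partition (forests d 1 k)
    where
    isForest : ∀ {f} → f ∈ forests d 1 k → IsForest d 2 k (cons nil f)
    isForest p = cons-nil-isForest {d} {1} {k} (forests-sound d 1 k p)
    cons-nil-injective : ∀ {f f′} → cons nil f ≡ cons nil f′ → f ≡ f′
    cons-nil-injective refl = refl
    injective : ∀ {f f′} → f ∈ forests d 1 k → f′ ∈ forests d 1 k →
                singleton-partition f ≡ singleton-partition f′ → f ≡ f′
    injective {f} {f′} p q e =
        cons-nil-injective (partition-injective d k (cons nil f) (cons nil f′) (isForest p) (isForest q) e)
    good : ∀ f → IsForest d 2 k (cons nil f) →
           Good d (singleton-partition f) × blockSize (singleton-partition f) zero ≡ 1
    good (cons h nil) F = partition-good d k (cons nil (cons h nil)) F , blockSize-zero {d} {k} F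
    sound : ∀ {π} → π ∈ map singleton-partition (forests d 1 k) → Good d π × blockSize π zero ≡ 1
    sound = map-elim (λ π → Good d π × blockSize π zero ≡ 1) singleton-partition λ {f} q → good f (isForest q)
    list-complete : ∀ f → IsForest d 2 k f → blockSize (partition n f) zero ≡ 1 →
                    partition n f ∈ map singleton-partition (forests d 1 k)
    list-complete (cons g (cons h nil)) F@(cons _ _ a , w , s) b
      with width≡0⇒nil g (suc-injective (trans (sym (blockSize-zero {d} {k} F)) b))
    ... | refl = ∈-map⁺ singleton-partition (forests-complete d 1 k (a , suc-injective w , suc-injective s))
    complete : ∀ {π} → Good d π × blockSize π zero ≡ 1 → π ∈ map singleton-partition (forests d 1 k)
    complete (G , b) = let f , F , e = partition-surjective d k G in
      subst (_∈ map singleton-partition (forests d 1 k)) (sym e)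
        (list-complete f F (subst (λ π → blockSize π zero ≡ 1) e b))

theorem4p5 : (d k : ℕ) → 1 ≤ d →
    (Σ ℕ λ N → HasCardinality {suc (d * k)} (Good d) N ×
    N * (d * k + 2) ≡ 2 * ((d * k + 2) C k))
    ×
    (Σ ℕ λ M → HasCardinality {suc (d * k)} (λ π → Good d π × blockSize π zero ≡ 1) M ×
    M * (d * k + 1) ≡ (d * k + 1) C k)
theorem4p5 d k 1≤d =
  (length (forests d 2 k) , good-cardinality d k , length-forests d 2 k) ,
  (length (forests d 1 k) , good-singleton-cardinality d k , trans (length-forests d 1 k) (*-identityˡ _))
  where
  instance
    d≢0 : NonZero d
    d≢0 = >-nonZero 1≤d
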